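{- For any positive integers $\alpha,m,n,r$, we have $$\sum_{k=0}^{n-1}[k(k+2)]^r\,[2(k+1)]\,q^{(n-2-k)(2\alpha m+1)}\left(w_k^{(\alpha)}(x;q)\,w_{k+1}^{(\alpha)}(x;q)\right)^m\equiv 0\pmod{[n]},$$ where the congruence is in the ring $\mathbb{Z}[q,q^{ -1}][x]$.
   Context: Here $q$ and $x$ are indeterminates. For an integer $N$, $[N]=\frac{1-q^N}{1-q}$ is the $q$-integer, an element of $\mathbb{Z}[q,q^{ -1}]$; in particular $[k(k+2)]$ is the $q$-integer of the number $k(k+2)$. For nonnegative integers $N$ and integers $k$, $\left[\begin{matrix} N \\ k \end{matrix}\right]=\frac{\prod_{1\le j\le k}[N-j+1]}{\prod_{1\le j\le k}[j]}$ is the $q$-binomial coefficient, equal to $1$ if $k=0$ and to $0$ if $k<0$ or $k>N$. For a nonnegative integer $k$ and a positive integer $\alpha$, $$w_k^{(\alpha)}(x;q)=\sum_{j=1}^{k}q^{\alpha\left(\binom{j+1}{2}-(k+1)(j-1)\right)}\left(\left[\begin{matrix} k-1 \\ j-1 \end{matrix}\right]\left[\begin{matrix} k+j \\ j \end{matrix}\right]-\left[\begin{matrix} k \\ j \end{matrix}\right]\left[\begin{matrix} k+j \\ j-1 \end{matrix}\right]\right)^{\alpha}x^{j-1}\in\mathbb{Z}[q,q^{ -1}][x],$$ with $w_0^{(\alpha)}(x;q)=0$ (empty sum). A congruence $A\equiv 0\pmod{P(q)}$ means that $P(q)$ divides $A$ in $\mathbb{Z}[q,q^{ -1}][x]$.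 -}

module Defs where

open import Algebra.Bundles using (CommutativeRing; Semiring)
open import Algebra.Structures using (IsCommutativeMonoid)
open import Data.Bool.Base using (true; false; if_then_else_)
open import Data.Fin.Base using (Fin; toℕ)
open import Data.Fin.Properties using (toℕ-inject₁; toℕ-fromℕ)
open import Data.Integer.Base as ℤ using (ℤ; +_; -[1+_])
import Data.Integer.Properties as ℤ
open import Data.Integer.Solver using (module +-*-Solver)
open import Data.List.Base using (List; []; _∷_; _++_; map; concatMap; filter; length)
open import Data.List.Properties using (length-filter)
open import Data.Nat.Base as ℕ using (ℕ; zero; suc; z≤n; s≤s)
open import Data.Nat.Combinatorics using (_C_)
import Data.Nat.Properties as ℕ
open import Data.Product.Base using (_×_; _,_; proj₂; map₁)
open import Level using (Level; _⊔_)
open import Relation.Binary.Definitions using (DecidableEquality)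
open import Relation.Binary.PropositionalEquality.Core as ≡ using (_≡_)
open import Relation.Nullary.Decidable.Core using (does; yes; no; ¬?)
open import Relation.Nullary.Negation.Core using (contradiction)

import Algebra.Definitions.RawMagma as RawMagma
import Algebra.Definitions.RawSemiring as RawSemiring
import Algebra.Properties.CommutativeSemigroup as CommutativeSemigroupProperties
import Algebra.Properties.Monoid.Sum as MonoidSum
import Algebra.Properties.Ring as RingProperties
import Relation.Binary.Reasoning.Setoid as SetoidReasoning

-- The monoid algebra R[M], for M written additively in the exponents:
-- R[ℕ] is the polynomial ring and R[ℤ] the Laurent polynomial ring over R.

module MonoidAlgebra
  {c ℓ : Level} (R : CommutativeRing c ℓ)
  {M : Set} {_∙_ : M → M → M} {ε : M}
  (isCommutativeMonoid : IsCommutativeMonoid _≡_ _∙_ ε)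
  (_≟_ : DecidableEquality M)
  where

  open CommutativeRing R
  private
    module M = IsCommutativeMonoid isCommutativeMonoid
    module +-CS = CommutativeSemigroupProperties +-commutativeSemigroup
    module *-CS = CommutativeSemigroupProperties *-commutativeSemigroup
    module RP = RingProperties ring
  open SetoidReasoning setoid

  -- A formal sum of terms (a , i), each standing for a times the monomial with
  -- exponent i. Exponents may repeat and coefficients may vanish; formal sums
  -- are identified when all their collected coefficients agree.

  FormalSum : Set c
  FormalSum = List (Carrier × M)

  coeff : FormalSum → M → Carrier
  coeff []            e = 0#
  coeff ((a , i) ∷ p) e = if does (i ≟ e) then a + coeff p e else coeff p e

  infix 4 _≈ₚ_
  record _≈ₚ_ (p p′ : FormalSum) : Set ℓ where
    constructor mk≈
    field
      coeff-≈ : ∀ e → coeff p e ≈ coeff p′ e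
  open _≈ₚ_ public

  monomial : Carrier → M → FormalSum
  monomial a i = (a , i) ∷ []

  const : Carrier → FormalSum
  const a = monomial a ε

  infixl 6 _+ₚ_
  _+ₚ_ : FormalSum → FormalSum → FormalSum
  _+ₚ_ = _++_

  -ₚ_ : FormalSum → FormalSum
  -ₚ_ = map (map₁ (-_))

  infixl 7 _*ₚ_
  _*ₚ_ : FormalSum → FormalSum → FormalSum
  p *ₚ p′ = concatMap (λ (a , i) → map (λ (b , j) → (a * b , i ∙ j)) p′) p

  -- The R-linear extension of f : M → R. Equality of formal sums amounts to
  -- equality under all these functionals, which yields the ring laws.

  extend : FormalSum → (M → Carrier) → Carrier
  extend []            f = 0#
  extend ((a , i) ∷ p) f = a * f i + extend p f

  private
    δ : M → M → Carrier
    δ e i = if does (i ≟ e) then 1# else 0#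

    remove : M → FormalSum → FormalSum
    remove u = filter (λ t → ¬? (proj₂ t ≟ u))

  coeff-extend : ∀ p e → coeff p e ≈ extend p (δ e)
  coeff-extend []            e = refl
  coeff-extend ((a , i) ∷ p) e with does (i ≟ e)
  ... | true  = +-cong (sym (*-identityʳ a)) (coeff-extend p e)
  ... | false = trans (coeff-extend p e)
                  (trans (sym (+-identityˡ _)) (+-congʳ (sym (zeroʳ a))))

  extend-cong : ∀ p {f g} → (∀ i → f i ≈ g i) → extend p f ≈ extend p g
  extend-cong []            f≈g = refl
  extend-cong ((a , i) ∷ p) f≈g = +-cong (*-congˡ (f≈g i)) (extend-cong p f≈g)

  extend-+ₚ : ∀ p p′ f → extend (p +ₚ p′) f ≈ extend p f + extend p′ f
  extend-+ₚ []            p′ f = sym (+-identityˡ _)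
  extend-+ₚ ((a , i) ∷ p) p′ f =
    trans (+-congˡ (extend-+ₚ p p′ f)) (sym (+-assoc _ _ _))

  extend--ₚ : ∀ p f → extend (-ₚ p) f ≈ - extend p f
  extend--ₚ []            f = sym RP.-0#≈0#
  extend--ₚ ((a , i) ∷ p) f = begin
    - a * f i + extend (-ₚ p) f  ≈⟨ +-cong (sym (RP.-‿distribˡ-* a (f i))) (extend--ₚ p f) ⟩
    - (a * f i) + - extend p f   ≈⟨ RP.-‿+-comm _ _ ⟩
    - (a * f i + extend p f)     ∎

  private
    extend-scale : ∀ a i p f →
      extend (map (λ (b , j) → (a * b , i ∙ j)) p) f ≈ a * extend p (λ j → f (i ∙ j))
    extend-scale a i []            f = sym (zeroʳ a)
    extend-scale a i ((b , j) ∷ p) f = begin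
      (a * b) * f (i ∙ j) + extend (map _ p) f                ≈⟨ +-cong (*-assoc _ _ _) (extend-scale a i p f) ⟩
      a * (b * f (i ∙ j)) + a * extend p (λ j → f (i ∙ j))    ≈⟨ distribˡ _ _ _ ⟨
      a * (b * f (i ∙ j) + extend p (λ j → f (i ∙ j)))        ∎

  extend-*ₚ : ∀ p p′ f →
    extend (p *ₚ p′) f ≈ extend p (λ i → extend p′ (λ j → f (i ∙ j)))
  extend-*ₚ []            p′ f = refl
  extend-*ₚ ((a , i) ∷ p) p′ f = trans
    (extend-+ₚ (map (λ (b , j) → (a * b , i ∙ j)) p′) (p *ₚ p′) f)
    (+-cong (extend-scale a i p′ f) (extend-*ₚ p p′ f))

  private
    extend-0 : ∀ p → extend p (λ _ → 0#) ≈ 0#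
    extend-0 []            = refl
    extend-0 ((a , i) ∷ p) = trans (+-cong (zeroʳ a) (extend-0 p)) (+-identityˡ _)

    extend-linear : ∀ p a f g →
      extend p (λ i → a * f i + g i) ≈ a * extend p f + extend p g
    extend-linear []            a f g = sym (trans (+-identityʳ _) (zeroʳ a))
    extend-linear ((b , i) ∷ p) a f g = begin
      b * (a * f i + g i) + extend p (λ i → a * f i + g i)
        ≈⟨ +-cong (distribˡ _ _ _) (extend-linear p a f g) ⟩
      (b * (a * f i) + b * g i) + (a * extend p f + extend p g)
        ≈⟨ +-CS.interchange _ _ _ _ ⟩
      (b * (a * f i) + a * extend p f) + (b * g i + extend p g)
        ≈⟨ +-congʳ (+-congʳ (*-CS.x∙yz≈y∙xz _ _ _)) ⟩
      (a * (b * f i) + a * extend p f) + (b * g i + extend p g)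
        ≈⟨ +-congʳ (distribˡ _ _ _) ⟨
      a * (b * f i + extend p f) + (b * g i + extend p g)
        ∎

    extend-swap : ∀ p p′ (f : M → M → Carrier) →
      extend p (λ i → extend p′ (f i)) ≈ extend p′ (λ j → extend p (λ i → f i j))
    extend-swap []            p′ f = sym (extend-0 p′)
    extend-swap ((a , i) ∷ p) p′ f = begin
      a * extend p′ (f i) + extend p (λ i → extend p′ (f i))          ≈⟨ +-congˡ (extend-swap p p′ f) ⟩
      a * extend p′ (f i) + extend p′ (λ j → extend p (λ i → f i j))  ≈⟨ extend-linear p′ a (f i) _ ⟨
      extend p′ (λ j → a * f i j + extend p (λ i → f i j))            ∎

    extend-remove : ∀ u p f → extend p f ≈ coeff p u * f u + extend (remove u p) f
    extend-remove u []            f = sym (trans (+-identityʳ _) (zeroˡ _))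
    extend-remove u ((a , i) ∷ p) f with i ≟ u
    ... | yes ≡.refl = begin
      a * f i + extend p f                                       ≈⟨ +-congˡ (extend-remove i p f) ⟩
      a * f i + (coeff p i * f i + extend (remove i p) f)        ≈⟨ +-assoc _ _ _ ⟨
      (a * f i + coeff p i * f i) + extend (remove i p) f        ≈⟨ +-congʳ (distribʳ _ _ _) ⟨
      (a + coeff p i) * f i + extend (remove i p) f              ∎
    ... | no _ = begin
      a * f i + extend p f                                       ≈⟨ +-congˡ (extend-remove u p f) ⟩
      a * f i + (coeff p u * f u + extend (remove u p) f)        ≈⟨ +-CS.x∙yz≈y∙xz _ _ _ ⟩
      coeff p u * f u + (a * f i + extend (remove u p) f)        ∎

    coeff-remove : ∀ u p → (∀ e → coeff p e ≈ 0#) → ∀ e → coeff (remove u p) e ≈ 0#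
    coeff-remove u p p≈0 e = begin
      coeff (remove u p) e                                 ≈⟨ coeff-extend (remove u p) e ⟩
      extend (remove u p) (δ e)                            ≈⟨ +-identityˡ _ ⟨
      0# + extend (remove u p) (δ e)                       ≈⟨ +-congʳ (zeroˡ _) ⟨
      0# * δ e u + extend (remove u p) (δ e)               ≈⟨ +-congʳ (*-congʳ (p≈0 u)) ⟨
      coeff p u * δ e u + extend (remove u p) (δ e)        ≈⟨ extend-remove u p (δ e) ⟨
      extend p (δ e)                                       ≈⟨ coeff-extend p e ⟨
      coeff p e                                            ≈⟨ p≈0 e ⟩
      0#                                                   ∎

    remove-head : ∀ a i p → remove i ((a , i) ∷ p) ≡ remove i p
    remove-head a i p with i ≟ i
    ... | yes _  = ≡.refl
    ... | no i≢i = contradiction ≡.refl i≢i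

    extend-vanish : ∀ n p f → length p ℕ.≤ n → (∀ e → coeff p e ≈ 0#) → extend p f ≈ 0#
    extend-vanish n       []                 f _         p≈0 = refl
    extend-vanish (suc n) p@((a , i) ∷ p′) f (s≤s ∣p′∣≤n) p≈0 = begin
      extend p f                               ≈⟨ extend-remove i p f ⟩
      coeff p i * f i + extend (remove i p) f  ≈⟨ +-cong (*-congʳ (p≈0 i)) rest ⟩
      0# * f i + 0#                            ≈⟨ trans (+-identityʳ _) (zeroˡ _) ⟩
      0#                                       ∎
      where
      short : length (remove i p) ℕ.≤ n
      short = ≡.subst (λ l → length l ℕ.≤ n) (≡.sym (remove-head a i p′))
                (ℕ.≤-trans (length-filter _ p′) ∣p′∣≤n)
      rest : extend (remove i p) f ≈ 0#
      rest = extend-vanish n (remove i p) f short (coeff-remove i p p≈0)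

  extend-≈ₚ : ∀ {p p′} → p ≈ₚ p′ → ∀ f → extend p f ≈ extend p′ f
  extend-≈ₚ {p} {p′} p≈p′ f = RP.x∙y⁻¹≈ε⇒x≈y _ _ (begin
    extend p f - extend p′ f         ≈⟨ difference f ⟨
    extend (p +ₚ -ₚ p′) f            ≈⟨ extend-vanish _ (p +ₚ -ₚ p′) f ℕ.≤-refl vanish ⟩
    0#                               ∎)
    where
    difference : ∀ g → extend (p +ₚ -ₚ p′) g ≈ extend p g - extend p′ g
    difference g = trans (extend-+ₚ p (-ₚ p′) g) (+-congˡ (extend--ₚ p′ g))
    vanish : ∀ e → coeff (p +ₚ -ₚ p′) e ≈ 0#
    vanish e = begin
      coeff (p +ₚ -ₚ p′) e               ≈⟨ coeff-extend (p +ₚ -ₚ p′) e ⟩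
      extend (p +ₚ -ₚ p′) (δ e)          ≈⟨ difference (δ e) ⟩
      extend p (δ e) - extend p′ (δ e)   ≈⟨ +-cong (coeff-extend p e) (-‿cong (coeff-extend p′ e)) ⟨
      coeff p e - coeff p′ e             ≈⟨ +-congʳ (coeff-≈ p≈p′ e) ⟩
      coeff p′ e - coeff p′ e            ≈⟨ -‿inverseʳ _ ⟩
      0#                                 ∎

  extend-injective : ∀ {p p′} → (∀ f → extend p f ≈ extend p′ f) → p ≈ₚ p′
  extend-injective {p} {p′} eq .coeff-≈ e =
    trans (coeff-extend p e) (trans (eq (δ e)) (sym (coeff-extend p′ e)))

  private
    +ₚ-cong : ∀ {p p′ r r′} → p ≈ₚ p′ → r ≈ₚ r′ → p +ₚ r ≈ₚ p′ +ₚ r′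
    +ₚ-cong {p} {p′} {r} {r′} p≈p′ r≈r′ = extend-injective λ f → begin
      extend (p +ₚ r) f            ≈⟨ extend-+ₚ p r f ⟩
      extend p f + extend r f      ≈⟨ +-cong (extend-≈ₚ p≈p′ f) (extend-≈ₚ r≈r′ f) ⟩
      extend p′ f + extend r′ f    ≈⟨ extend-+ₚ p′ r′ f ⟨
      extend (p′ +ₚ r′) f          ∎

    +ₚ-comm : ∀ p r → p +ₚ r ≈ₚ r +ₚ p
    +ₚ-comm p r = extend-injective λ f →
      trans (extend-+ₚ p r f) (trans (+-comm _ _) (sym (extend-+ₚ r p f)))

    +ₚ-assoc : ∀ p r s → (p +ₚ r) +ₚ s ≈ₚ p +ₚ (r +ₚ s)
    +ₚ-assoc p r s = extend-injective λ f → begin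
      extend ((p +ₚ r) +ₚ s) f                ≈⟨ trans (extend-+ₚ (p +ₚ r) s f) (+-congʳ (extend-+ₚ p r f)) ⟩
      (extend p f + extend r f) + extend s f  ≈⟨ +-assoc _ _ _ ⟩
      extend p f + (extend r f + extend s f)  ≈⟨ trans (extend-+ₚ p (r +ₚ s) f) (+-congˡ (extend-+ₚ r s f)) ⟨
      extend (p +ₚ (r +ₚ s)) f                ∎

    +ₚ-identityʳ : ∀ p → p +ₚ [] ≈ₚ p
    +ₚ-identityʳ p = extend-injective λ f → trans (extend-+ₚ p [] f) (+-identityʳ _)

    -ₚ-cong : ∀ {p p′} → p ≈ₚ p′ → -ₚ p ≈ₚ -ₚ p′
    -ₚ-cong {p} {p′} p≈p′ = extend-injective λ f →
      trans (extend--ₚ p f) (trans (-‿cong (extend-≈ₚ p≈p′ f)) (sym (extend--ₚ p′ f)))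

    -ₚ-inverseʳ : ∀ p → p +ₚ -ₚ p ≈ₚ []
    -ₚ-inverseʳ p = extend-injective λ f →
      trans (extend-+ₚ p (-ₚ p) f) (trans (+-congˡ (extend--ₚ p f)) (-‿inverseʳ _))

    *ₚ-cong : ∀ {p p′ r r′} → p ≈ₚ p′ → r ≈ₚ r′ → p *ₚ r ≈ₚ p′ *ₚ r′
    *ₚ-cong {p} {p′} {r} {r′} p≈p′ r≈r′ = extend-injective λ f → begin
      extend (p *ₚ r) f                                 ≈⟨ extend-*ₚ p r f ⟩
      extend p (λ i → extend r (λ j → f (i ∙ j)))       ≈⟨ extend-≈ₚ p≈p′ _ ⟩
      extend p′ (λ i → extend r (λ j → f (i ∙ j)))      ≈⟨ extend-cong p′ (λ i → extend-≈ₚ r≈r′ _) ⟩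
      extend p′ (λ i → extend r′ (λ j → f (i ∙ j)))     ≈⟨ extend-*ₚ p′ r′ f ⟨
      extend (p′ *ₚ r′) f                               ∎

    *ₚ-comm : ∀ p r → p *ₚ r ≈ₚ r *ₚ p
    *ₚ-comm p r = extend-injective λ f → begin
      extend (p *ₚ r) f                              ≈⟨ extend-*ₚ p r f ⟩
      extend p (λ i → extend r (λ j → f (i ∙ j)))    ≈⟨ extend-swap p r _ ⟩
      extend r (λ j → extend p (λ i → f (i ∙ j)))    ≈⟨ extend-cong r (λ j → extend-cong p (λ i →
                                                          reflexive (≡.cong f (M.comm i j)))) ⟩
      extend r (λ j → extend p (λ i → f (j ∙ i)))    ≈⟨ extend-*ₚ r p f ⟨
      extend (r *ₚ p) f                              ∎

    *ₚ-assoc : ∀ p r s → (p *ₚ r) *ₚ s ≈ₚ p *ₚ (r *ₚ s)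
    *ₚ-assoc p r s = extend-injective λ f → begin
      extend ((p *ₚ r) *ₚ s) f
        ≈⟨ trans (extend-*ₚ (p *ₚ r) s f) (extend-*ₚ p r _) ⟩
      extend p (λ i → extend r (λ j → extend s (λ k → f ((i ∙ j) ∙ k))))
        ≈⟨ extend-cong p (λ i → extend-cong r (λ j → extend-cong s (λ k →
             reflexive (≡.cong f (M.assoc i j k))))) ⟩
      extend p (λ i → extend r (λ j → extend s (λ k → f (i ∙ (j ∙ k)))))
        ≈⟨ trans (extend-*ₚ p (r *ₚ s) f) (extend-cong p (λ i → extend-*ₚ r s _)) ⟨
      extend (p *ₚ (r *ₚ s)) f
        ∎

    *ₚ-identityˡ : ∀ p → const 1# *ₚ p ≈ₚ p
    *ₚ-identityˡ p = extend-injective λ f → begin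
      extend (const 1# *ₚ p) f                    ≈⟨ extend-*ₚ (const 1#) p f ⟩
      1# * extend p (λ j → f (ε ∙ j)) + 0#        ≈⟨ trans (+-identityʳ _) (*-identityˡ _) ⟩
      extend p (λ j → f (ε ∙ j))                  ≈⟨ extend-cong p (λ j → reflexive (≡.cong f (M.identityˡ j))) ⟩
      extend p f                                  ∎

    *ₚ-distribʳ-+ₚ : ∀ s p r → (p +ₚ r) *ₚ s ≈ₚ p *ₚ s +ₚ r *ₚ s
    *ₚ-distribʳ-+ₚ s p r = extend-injective λ f → begin
      extend ((p +ₚ r) *ₚ s) f                  ≈⟨ trans (extend-*ₚ (p +ₚ r) s f) (extend-+ₚ p r _) ⟩
      extend p _ + extend r _                   ≈⟨ +-cong (extend-*ₚ p s f) (extend-*ₚ r s f) ⟨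
      extend (p *ₚ s) f + extend (r *ₚ s) f     ≈⟨ extend-+ₚ (p *ₚ s) (r *ₚ s) f ⟨
      extend (p *ₚ s +ₚ r *ₚ s) f               ∎

    refl-≈ₚ : ∀ {p} → p ≈ₚ p
    refl-≈ₚ = mk≈ λ e → refl

    sym-≈ₚ : ∀ {p p′} → p ≈ₚ p′ → p′ ≈ₚ p
    sym-≈ₚ p≈p′ = mk≈ λ e → sym (coeff-≈ p≈p′ e)

    trans-≈ₚ : ∀ {p p′ p″} → p ≈ₚ p′ → p′ ≈ₚ p″ → p ≈ₚ p″
    trans-≈ₚ eq eq′ = mk≈ λ e → trans (coeff-≈ eq e) (coeff-≈ eq′ e)

  commutativeRing : CommutativeRing c ℓ
  commutativeRing = record
    { Carrier = FormalSum
    ; _≈_     = _≈ₚ_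
    ; _+_     = _+ₚ_
    ; _*_     = _*ₚ_
    ; -_      = -ₚ_
    ; 0#      = []
    ; 1#      = const 1#
    ; isCommutativeRing = record
      { isRing = record
        { +-isAbelianGroup = record
          { isGroup = record
            { isMonoid = record
              { isSemigroup = record
                { isMagma = record
                  { isEquivalence = record
                    { refl = refl-≈ₚ ; sym = sym-≈ₚ ; trans = trans-≈ₚ }
                  ; ∙-cong = +ₚ-cong
                  }
                ; assoc = +ₚ-assoc
                }
              ; identity = (λ _ → refl-≈ₚ) , +ₚ-identityʳ
              }
            ; inverse = (λ p → trans-≈ₚ (+ₚ-comm (-ₚ p) p) (-ₚ-inverseʳ p)) , -ₚ-inverseʳ
            ; ⁻¹-cong = -ₚ-cong
            }
          ; comm = +ₚ-comm
          }
        ; *-cong     = *ₚ-cong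
        ; *-assoc    = *ₚ-assoc
        ; *-identity = *ₚ-identityˡ
                     , (λ p → trans-≈ₚ (*ₚ-comm p (const 1#)) (*ₚ-identityˡ p))
        ; distrib    = (λ s p r → trans-≈ₚ (*ₚ-comm s (p +ₚ r))
                         (trans-≈ₚ (*ₚ-distribʳ-+ₚ s p r)
                           (+ₚ-cong (*ₚ-comm p s) (*ₚ-comm r s))))
                     , *ₚ-distribʳ-+ₚ
        }
      ; *-comm = *ₚ-comm
      }
    }

module QAnalogues
  {c ℓ : Level} (R : CommutativeRing c ℓ)
  (q^_ : ℤ → CommutativeRing.Carrier R)
  (q^0≈1 : CommutativeRing._≈_ R (q^ (+ 0)) (CommutativeRing.1# R))
  (q^-homo : ∀ a b → CommutativeRing._≈_ R (CommutativeRing._*_ R (q^ a) (q^ b)) (q^ (a ℤ.+ b)))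
  where

  open CommutativeRing R
  open RawSemiring (Semiring.rawSemiring semiring) using (_^_; _∣_; product)
  open RawMagma *-rawMagma using (_∣ʳ_; _,_)
  open SetoidReasoning setoid
  private
    module RP = RingProperties ring
    module *-CS = CommutativeSemigroupProperties *-commutativeSemigroup
    module ∏ = MonoidSum *-monoid

  -- Used below only in the integral domain ℤ[q,q⁻¹], where a quotient by a nonzero
  -- element does not depend on the divisibility proof it is read off from.

  quotient : ∀ {a b} → b ∣ a → Carrier
  quotient = _∣ʳ_.quotient

  private
    geometric : ℤ → Carrier
    geometric (+ zero)     = 0#
    geometric (+ suc n)    = geometric (+ n) + q^ (+ n)
    geometric -[1+ zero ]  = - q^ -[1+ 0 ]
    geometric -[1+ suc n ] = geometric -[1+ n ] - q^ -[1+ suc n ]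

    x-y+y≈x : ∀ x y → (x - y) + y ≈ x
    x-y+y≈x x y = trans (+-assoc _ _ _) (trans (+-congˡ (-‿inverseˡ y)) (+-identityʳ x))

    geometric-suc : ∀ N → geometric (+ 1 ℤ.+ N) ≈ geometric N + q^ N
    geometric-suc (+ n)        = refl
    geometric-suc -[1+ zero ]  = sym (-‿inverseˡ (q^ -[1+ 0 ]))
    geometric-suc -[1+ suc n ] = sym (x-y+y≈x (geometric -[1+ n ]) (q^ -[1+ suc n ]))

    geometric-pred : ∀ N → geometric N ≈ geometric (+ 1 ℤ.+ N) - q^ N
    geometric-pred N = sym (begin
      geometric (+ 1 ℤ.+ N) - q^ N       ≈⟨ +-congʳ (geometric-suc N) ⟩
      (geometric N + q^ N) - q^ N        ≈⟨ +-assoc _ _ _ ⟩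
      geometric N + (q^ N - q^ N)        ≈⟨ +-congˡ (-‿inverseʳ (q^ N)) ⟩
      geometric N + 0#                   ≈⟨ +-identityʳ _ ⟩
      geometric N                        ∎)

    ℤ-induction : ∀ {ℓ} (P : ℤ → Set ℓ) → P (+ 0) →
      (∀ N → P N → P (+ 1 ℤ.+ N)) → (∀ N → P (+ 1 ℤ.+ N) → P N) → ∀ N → P N
    ℤ-induction P p0 up down (+ zero)     = p0
    ℤ-induction P p0 up down (+ suc n)    = up (+ n) (ℤ-induction P p0 up down (+ n))
    ℤ-induction P p0 up down -[1+ zero ]  = down -[1+ 0 ] p0
    ℤ-induction P p0 up down -[1+ suc n ] = down -[1+ suc n ] (ℤ-induction P p0 up down -[1+ n ])

    q^N*[1-q] : ∀ N → q^ N * (1# - q^ (+ 1)) ≈ q^ N - q^ (+ 1 ℤ.+ N)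
    q^N*[1-q] N = begin
      q^ N * (1# - q^ (+ 1))             ≈⟨ distribˡ _ _ _ ⟩
      q^ N * 1# + q^ N * - q^ (+ 1)      ≈⟨ +-cong (*-identityʳ (q^ N)) (sym (RP.-‿distribʳ-* (q^ N) (q^ (+ 1)))) ⟩
      q^ N - q^ N * q^ (+ 1)             ≈⟨ +-congˡ (-‿cong (q^-homo N (+ 1))) ⟩
      q^ N - q^ (N ℤ.+ + 1)              ≡⟨ ≡.cong (λ K → q^ N - q^ K) (ℤ.+-comm N (+ 1)) ⟩
      q^ N - q^ (+ 1 ℤ.+ N)              ∎

    telescope : ∀ x y z → (x - y) + (y - z) ≈ x - z
    telescope x y z = begin
      (x - y) + (y - z)     ≈⟨ +-assoc _ _ _ ⟨
      ((x - y) + y) - z     ≈⟨ +-congʳ (x-y+y≈x x y) ⟩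
      x - z                 ∎

    geometric-quotient : ∀ N → geometric N * (1# - q^ (+ 1)) ≈ 1# - q^ N
    geometric-quotient = ℤ-induction _ base up down
      where
      base : 0# * (1# - q^ (+ 1)) ≈ 1# - q^ (+ 0)
      base = trans (zeroˡ _) (sym (trans (+-congˡ (-‿cong q^0≈1)) (-‿inverseʳ 1#)))
      up : ∀ N → geometric N * (1# - q^ (+ 1)) ≈ 1# - q^ N →
           geometric (+ 1 ℤ.+ N) * (1# - q^ (+ 1)) ≈ 1# - q^ (+ 1 ℤ.+ N)
      up N ih = begin
        geometric (+ 1 ℤ.+ N) * (1# - q^ (+ 1))                      ≈⟨ *-congʳ (geometric-suc N) ⟩
        (geometric N + q^ N) * (1# - q^ (+ 1))                       ≈⟨ distribʳ _ _ _ ⟩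
        geometric N * (1# - q^ (+ 1)) + q^ N * (1# - q^ (+ 1))       ≈⟨ +-cong ih (q^N*[1-q] N) ⟩
        (1# - q^ N) + (q^ N - q^ (+ 1 ℤ.+ N))                        ≈⟨ telescope _ _ _ ⟩
        1# - q^ (+ 1 ℤ.+ N)                                          ∎
      down : ∀ N → geometric (+ 1 ℤ.+ N) * (1# - q^ (+ 1)) ≈ 1# - q^ (+ 1 ℤ.+ N) →
             geometric N * (1# - q^ (+ 1)) ≈ 1# - q^ N
      down N ih = begin
        geometric N * (1# - q^ (+ 1))                                ≈⟨ *-congʳ (geometric-pred N) ⟩
        (geometric (+ 1 ℤ.+ N) - q^ N) * (1# - q^ (+ 1))             ≈⟨ distribʳ _ _ _ ⟩
        geometric (+ 1 ℤ.+ N) * (1# - q^ (+ 1)) + - q^ N * (1# - q^ (+ 1))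
          ≈⟨ +-cong ih (trans (sym (RP.-‿distribˡ-* (q^ N) (1# - q^ (+ 1)))) (-‿cong (q^N*[1-q] N))) ⟩
        (1# - q^ (+ 1 ℤ.+ N)) + - (q^ N - q^ (+ 1 ℤ.+ N))            ≈⟨ +-congˡ (RP.⁻¹-anti-homo‿- _ _) ⟩
        (1# - q^ (+ 1 ℤ.+ N)) + (q^ (+ 1 ℤ.+ N) - q^ N)              ≈⟨ telescope _ _ _ ⟩
        1# - q^ N                                                    ∎

  1-q∣1-q^ : ∀ N → (1# - q^ (+ 1)) ∣ (1# - q^ N)
  1-q∣1-q^ N = geometric N , geometric-quotient N

  [_] : ℤ → Carrier
  [ N ] = quotient (1-q∣1-q^ N)

  [+]-split : ∀ a b → [ a ] + q^ a * [ b ] ≈ [ a ℤ.+ b ]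
  [+]-split a = ℤ-induction _ base up down
    where
    assoc′ : ∀ b → a ℤ.+ (+ 1 ℤ.+ b) ≡ + 1 ℤ.+ (a ℤ.+ b)
    assoc′ b = ≡.trans (≡.sym (ℤ.+-assoc a (+ 1) b))
      (≡.trans (≡.cong (ℤ._+ b) (ℤ.+-comm a (+ 1))) (ℤ.+-assoc (+ 1) a b))
    base : [ a ] + q^ a * [ + 0 ] ≈ [ a ℤ.+ + 0 ]
    base = trans (+-congˡ (zeroʳ (q^ a)))
             (trans (+-identityʳ _) (reflexive (≡.cong [_] (≡.sym (ℤ.+-identityʳ a)))))
    up : ∀ b → [ a ] + q^ a * [ b ] ≈ [ a ℤ.+ b ] →
         [ a ] + q^ a * [ + 1 ℤ.+ b ] ≈ [ a ℤ.+ (+ 1 ℤ.+ b) ]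
    up b ih = begin
      [ a ] + q^ a * [ + 1 ℤ.+ b ]               ≈⟨ +-congˡ (*-congˡ (geometric-suc b)) ⟩
      [ a ] + q^ a * ([ b ] + q^ b)              ≈⟨ +-congˡ (trans (distribˡ _ _ _) (+-congˡ (q^-homo a b))) ⟩
      [ a ] + (q^ a * [ b ] + q^ (a ℤ.+ b))      ≈⟨ +-assoc _ _ _ ⟨
      ([ a ] + q^ a * [ b ]) + q^ (a ℤ.+ b)      ≈⟨ +-congʳ ih ⟩
      [ a ℤ.+ b ] + q^ (a ℤ.+ b)                 ≈⟨ geometric-suc (a ℤ.+ b) ⟨
      [ + 1 ℤ.+ (a ℤ.+ b) ]                      ≡⟨ ≡.cong [_] (assoc′ b) ⟨
      [ a ℤ.+ (+ 1 ℤ.+ b) ]                      ∎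
    down : ∀ b → [ a ] + q^ a * [ + 1 ℤ.+ b ] ≈ [ a ℤ.+ (+ 1 ℤ.+ b) ] →
           [ a ] + q^ a * [ b ] ≈ [ a ℤ.+ b ]
    down b ih = begin
      [ a ] + q^ a * [ b ]                                ≈⟨ +-congˡ (*-congˡ (geometric-pred b)) ⟩
      [ a ] + q^ a * ([ + 1 ℤ.+ b ] - q^ b)               ≈⟨ +-congˡ (distribˡ _ _ _) ⟩
      [ a ] + (q^ a * [ + 1 ℤ.+ b ] + q^ a * - q^ b)      ≈⟨ +-assoc _ _ _ ⟨
      ([ a ] + q^ a * [ + 1 ℤ.+ b ]) + q^ a * - q^ b      ≈⟨ +-cong ih (trans (sym (RP.-‿distribʳ-* (q^ a) (q^ b))) (-‿cong (q^-homo a b))) ⟩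
      [ a ℤ.+ (+ 1 ℤ.+ b) ] - q^ (a ℤ.+ b)                ≡⟨ ≡.cong (λ K → [ K ] - q^ (a ℤ.+ b)) (assoc′ b) ⟩
      [ + 1 ℤ.+ (a ℤ.+ b) ] - q^ (a ℤ.+ b)                ≈⟨ geometric-pred (a ℤ.+ b) ⟨
      [ a ℤ.+ b ]                                         ∎

  ∏₁ : ℕ → (ℕ → Carrier) → Carrier
  ∏₁ k f = product (λ (i : Fin k) → f (suc (toℕ i)))

  syntax ∏₁ k (λ j → t) = ∏[1≤ j ≤ k ] t

  private
    ∏₁-cong : ∀ k {f g : ℕ → Carrier} → (∀ j → f j ≡ g j) → ∏₁ k f ≈ ∏₁ k g
    ∏₁-cong k f≡g = ∏.sum-cong-≋ {k} (λ i → reflexive (f≡g _))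

    ∏₁-last : ∀ k f → ∏₁ (suc k) f ≈ ∏₁ k f * f (suc k)
    ∏₁-last k f = trans
      (∏.sum-init-last {k} (λ i → f (suc (toℕ i))))
      (*-cong (∏.sum-cong-≋ {k} (λ i → reflexive (≡.cong (λ j → f (suc j)) (toℕ-inject₁ i))))
              (reflexive (≡.cong (λ j → f (suc j)) (toℕ-fromℕ k))))

  denominator∣numerator : ∀ N k →
    (∏[1≤ j ≤ k ] [ + j ]) ∣ (∏[1≤ j ≤ k ] [ + N ℤ.- + j ℤ.+ + 1 ])
  denominator∣numerator N       zero    = 1# , *-identityʳ 1#
  denominator∣numerator zero    (suc k) = 0# , trans (zeroˡ _) (sym (zeroˡ _))
  denominator∣numerator (suc N) (suc k)
    with (b , b*D≈F) ← denominator∣numerator N k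
       | (b′ , b′*D′≈F′) ← denominator∣numerator N (suc k)
    = b + q^ (+ suc k) * b′ , (begin
      (b + q^ (+ suc k) * b′) * D (suc k)                           ≈⟨ distribʳ _ _ _ ⟩
      b * D (suc k) + q^ (+ suc k) * b′ * D (suc k)                 ≈⟨ +-cong left right ⟩
      F N k * [ + suc k ] + F N k * (q^ (+ suc k) * [ + N ℤ.- + k ])  ≈⟨ distribˡ _ _ _ ⟨
      F N k * ([ + suc k ] + q^ (+ suc k) * [ + N ℤ.- + k ])        ≈⟨ *-congˡ ([+]-split (+ suc k) (+ N ℤ.- + k)) ⟩
      F N k * [ + suc k ℤ.+ (+ N ℤ.- + k) ]                         ≡⟨ ≡.cong (λ K → F N k * [ K ]) top ⟩
      F N k * [ + suc N ]                                           ≈⟨ *-comm _ _ ⟩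
      [ + suc N ] * F N k                                           ≈⟨ *-cong (reflexive (≡.cong [_] first))
                                                                        (∏₁-cong k (λ j → ≡.cong [_] (shift j))) ⟨
      F (suc N) (suc k)                                             ∎)
    where
    D : ℕ → Carrier
    D k = ∏[1≤ j ≤ k ] [ + j ]
    F : ℕ → ℕ → Carrier
    F N k = ∏[1≤ j ≤ k ] [ + N ℤ.- + j ℤ.+ + 1 ]
    open +-*-Solver
    shift : ∀ j → + suc N ℤ.- + suc j ℤ.+ + 1 ≡ + N ℤ.- + j ℤ.+ + 1
    shift j = solve 2 (λ n j → (con (+ 1) :+ n) :- (con (+ 1) :+ j) :+ con (+ 1) := n :- j :+ con (+ 1))
                ≡.refl (+ N) (+ j)
    first : + suc N ℤ.- + 1 ℤ.+ + 1 ≡ + suc N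
    first = solve 1 (λ n → n :- con (+ 1) :+ con (+ 1) := n) ≡.refl (+ suc N)
    last : + N ℤ.- + suc k ℤ.+ + 1 ≡ + N ℤ.- + k
    last = solve 2 (λ n k → n :- (con (+ 1) :+ k) :+ con (+ 1) := n :- k) ≡.refl (+ N) (+ k)
    top : + suc k ℤ.+ (+ N ℤ.- + k) ≡ + suc N
    top = solve 2 (λ n k → (con (+ 1) :+ k) :+ (n :- k) := con (+ 1) :+ n) ≡.refl (+ N) (+ k)
    left : b * D (suc k) ≈ F N k * [ + suc k ]
    left = begin
      b * D (suc k)              ≈⟨ *-congˡ (∏₁-last k (λ j → [ + j ])) ⟩
      b * (D k * [ + suc k ])    ≈⟨ *-assoc _ _ _ ⟨
      b * D k * [ + suc k ]      ≈⟨ *-congʳ b*D≈F ⟩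
      F N k * [ + suc k ]        ∎
    right : q^ (+ suc k) * b′ * D (suc k) ≈ F N k * (q^ (+ suc k) * [ + N ℤ.- + k ])
    right = begin
      q^ (+ suc k) * b′ * D (suc k)                          ≈⟨ *-assoc (q^ (+ suc k)) b′ (D (suc k)) ⟩
      q^ (+ suc k) * (b′ * D (suc k))                        ≈⟨ *-congˡ b′*D′≈F′ ⟩
      q^ (+ suc k) * F N (suc k)                             ≈⟨ *-congˡ (∏₁-last k (λ j → [ + N ℤ.- + j ℤ.+ + 1 ])) ⟩
      q^ (+ suc k) * (F N k * [ + N ℤ.- + suc k ℤ.+ + 1 ])   ≡⟨ ≡.cong (λ K → q^ (+ suc k) * (F N k * [ K ])) last ⟩
      q^ (+ suc k) * (F N k * [ + N ℤ.- + k ])               ≈⟨ *-CS.x∙yz≈y∙xz _ _ _ ⟩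
      F N k * (q^ (+ suc k) * [ + N ℤ.- + k ])               ∎

  -- For k > N the numerator contains the factor [ + 0 ], so this is 0.

  qBinomial : ℕ → ℕ → Carrier
  qBinomial N k = quotient (denominator∣numerator N k)

  -- Used for 1 ≤ j ≤ k, where the truncated subtractions are exact.

  wCoefficient : ℕ → ℕ → ℕ → Carrier
  wCoefficient α k j =
    q^ (+ α ℤ.* (+ (suc j C 2) ℤ.- + (k ℕ.+ 1) ℤ.* (+ j ℤ.- + 1)))
    * (qBinomial (k ℕ.∸ 1) (j ℕ.∸ 1) * qBinomial (k ℕ.+ j) j
       - qBinomial k j * qBinomial (k ℕ.+ j) (j ℕ.∸ 1)) ^ α

module Laurent = MonoidAlgebra ℤ.+-*-commutativeRing ℤ.+-0-isCommutativeMonoid ℤ._≟_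

ℤ[q^±1] : CommutativeRing _ _
ℤ[q^±1] = Laurent.commutativeRing

module Polynomial = MonoidAlgebra ℤ[q^±1] ℕ.+-0-isCommutativeMonoid ℕ._≟_

ℤ[q^±1][x] : CommutativeRing _ _
ℤ[q^±1][x] = Polynomial.commutativeRing

q^_ : ℤ → CommutativeRing.Carrier ℤ[q^±1]
q^ N = Laurent.monomial (+ 1) N

module Q = QAnalogues ℤ[q^±1] q^_ (CommutativeRing.refl ℤ[q^±1])
             (λ a b → CommutativeRing.refl ℤ[q^±1])
open Q public using ([_]; qBinomial; wCoefficient)

open CommutativeRing ℤ[q^±1][x] public using (_*_)
open RawSemiring (Semiring.rawSemiring (CommutativeRing.semiring ℤ[q^±1][x])) public using (_^_; _∣_)
open MonoidSum (CommutativeRing.+-monoid ℤ[q^±1][x]) public using (sum-syntax)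
open Polynomial public using (const)

x : CommutativeRing.Carrier ℤ[q^±1][x]
x = Polynomial.monomial (CommutativeRing.1# ℤ[q^±1]) 1

-- The Fin index i stands for j = i + 1, running from 1 to k.

w : ℕ → ℕ → CommutativeRing.Carrier ℤ[q^±1][x]
w α k = ∑[ i < k ] (let j = suc (toℕ i) in const (wCoefficient α k j) * x ^ (j ℕ.∸ 1))

module Submission where

-- Modulo the d-th cyclotomic polynomial, q is a primitive d-th root of unity.
-- Writing w_k = q^(αk) W_k, the absorption identities for q-binomial coefficients
-- show that W_k = W_k′ whenever k and k′ lie strictly inside the same block of d
-- consecutive integers and k + k′ ≡ - 1 (mod d), although the denominators of the
-- product formula for w_k may vanish. Hence the k-th and k′-th summands cancel when
-- k + k′ ≡ - 2 (mod d) inside a block. In the border cases k ≡ 0, - 2 the factor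
-- [k(k+2)]^r vanishes, as r > 0, and for k ≡ - 1 so does [2(k+1)]. Every
-- block of d summands therefore vanishes, and with it the whole sum if d divides n.
--
-- Cyclotomic polynomials are avoided: y counts as divisible by the d-th one if [d]
-- divides m y for a product m of q-integers [k] with 0 < k < d. If this holds for
-- all d dividing n, then [n] divides y by induction on n: to drop a factor [k] from
-- [n] ∣ [k] y, replace k by g = gcd(k,n); as [g] divides y by induction and [n]/[g] is
-- n/g modulo [g], [n] divides (n/g) y, and n/g can be cancelled since
-- ℤ[q,q⁻¹]/([n]) is torsion-free.

open import Algebra.Bundles using (CommutativeRing)
open import Algebra.Morphism.Structures using (module RingMorphisms)
open import Data.Bool.Base using (true; false)
open import Data.Fin.Base using (Fin; zero; suc; toℕ; opposite)
import Data.Fin.Properties as Fin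
open import Data.Fin.Permutation using (reverse)
open import Data.Integer.Base as ℤ using (ℤ; +_; -[1+_])
open import Data.Integer.DivMod using (_%ℕ_; _/ℕ_; n%ℕd<d; a≡a%ℕn+[a/ℕn]*n)
import Data.Integer.Properties as ℤ
open import Data.Integer.Solver using (module +-*-Solver)
open import Data.List.Base using ([]; _∷_; map)
open import Data.List.Properties using (map-++)
open import Data.Nat.Base as ℕ using (ℕ; zero; suc; s≤s; NonZero)
open import Data.Nat.Combinatorics using (_C_)
open import Data.Nat.Divisibility as ℕ∣ using (divides)
open import Data.Nat.DivMod using (_/_; _%_; m≡m%n+[m/n]*n; m%n<n)
open import Data.Nat.GCD using (gcd; gcd-GCD; gcd[m,n]∣m; gcd[m,n]∣n; module Bézout)
open import Data.Nat.Induction using (<-rec)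
import Data.Nat.Properties as ℕ
import Data.Nat.Solver as ℕSolver
open import Data.Product.Base using (_×_; _,_; ∃-syntax; map₁; map₂)
open import Data.Sum.Base using (inj₁; inj₂)
open import Defs using (module QAnalogues)
open import Function.Base using (_∘_; id)
open import Level using (Level; _⊔_)
open import Relation.Binary.PropositionalEquality.Core as ≡ using (_≡_)
open import Relation.Nullary.Decidable.Core using (does)
open import Relation.Nullary.Negation.Core using (contradiction)

import Algebra.Definitions.RawMagma as RawMagma
import Algebra.Properties.CommutativeMonoid.Sum as CommutativeMonoidSum
import Algebra.Properties.CommutativeSemigroup as CommutativeSemigroupProperties
import Algebra.Properties.CommutativeSemigroup.Divisibility as CommutativeSemigroupDivisibility
import Algebra.Properties.CommutativeSemiring.Exp as Exponentiation
import Algebra.Properties.Monoid.Sum as MonoidSum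
import Algebra.Properties.Ring as RingProperties
import Algebra.Properties.Semiring.Divisibility as SemiringDivisibility
import Algebra.Properties.Semiring.Mult as Multiples
import Algebra.Properties.Semiring.Sum as SemiringSum
import Algebra.Solver.Ring.NaturalCoefficients.Default as SemiringSolver
import Relation.Binary.Reasoning.Setoid as SetoidReasoning

-- Absorption identities for q-binomial coefficients and the coefficients of w.

module QIdentities
  {c ℓ : Level} (R : CommutativeRing c ℓ)
  (q^_ : ℤ → CommutativeRing.Carrier R)
  (q^0≈1 : CommutativeRing._≈_ R (q^ (+ 0)) (CommutativeRing.1# R))
  (q^-homo : ∀ a b → CommutativeRing._≈_ R (CommutativeRing._*_ R (q^ a) (q^ b)) (q^ (a ℤ.+ b)))
  where

  open CommutativeRing R
  open QAnalogues R q^_ q^0≈1 q^-homo using ([_]; [+]-split; qBinomial)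
  open CommutativeSemigroupProperties *-commutativeSemigroup using (x∙yz≈y∙xz)
  open SetoidReasoning setoid
  private
    module RP = RingProperties ring
    module SS = SemiringSolver commutativeSemiring

  [-] : ∀ N → [ ℤ.- N ] ≈ - (q^ (ℤ.- N) * [ N ])
  [-] N = RP.+-inverseˡ-unique _ _
    (trans ([+]-split (ℤ.- N) N) (reflexive (≡.cong [_] (ℤ.+-inverseˡ N))))

  [1]≈1 : [ + 1 ] ≈ 1#
  [1]≈1 = trans (+-identityˡ _) q^0≈1

  -- The quotient behind `qBinomial` is the witness built in `denominator∣numerator`, which follows
  -- the q-Pascal rule. So q-binomials unfold by computation along that rule, here and in the proofs
  -- below.
  qBinomial-vanishes : ∀ {N k} → N ℕ.< k → qBinomial N k ≈ 0#
  qBinomial-vanishes {zero}  {suc k} _         = refl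
  qBinomial-vanishes {suc N} {suc k} (s≤s N<k) = begin
    qBinomial N k + q^ (+ suc k) * qBinomial N (suc k)
      ≈⟨ +-cong (qBinomial-vanishes N<k) (*-congˡ (qBinomial-vanishes (ℕ.m<n⇒m<1+n N<k))) ⟩
    0# + q^ (+ suc k) * 0#   ≈⟨ trans (+-identityˡ _) (zeroʳ _) ⟩
    0#                       ∎

  mutual
    -- Over a general ring one cannot divide by q-integers, so the two absorption identities are
    -- derived from the q-Pascal rule by a joint induction: `absorption-suc` at `N` uses
    -- `absorption` at `N`, and `absorption` at `suc N` uses both at `N`.
    absorption : ∀ N k → [ + suc k ] * qBinomial N (suc k) ≈ [ + N ℤ.- + k ] * qBinomial N k
    absorption zero    zero    = trans (zeroʳ _) (sym (zeroˡ _))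
    absorption zero    (suc k) = trans (zeroʳ _) (sym (zeroʳ _))
    absorption (suc N) zero    = begin
      [ + 1 ] * qBinomial (suc N) 1         ≈⟨ absorption-suc N 0 ⟩
      [ + suc N ] * qBinomial N 0           ≡⟨⟩
      [ + suc N ] * qBinomial (suc N) 0     ≡⟨ ≡.cong (λ K → [ K ] * qBinomial (suc N) 0) (ℤ.+-identityʳ (+ suc N)) ⟨
      [ + suc N ℤ.- + 0 ] * qBinomial (suc N) 0 ∎
    absorption (suc N) (suc k) = begin
      [ + suc (suc k) ] * qBinomial (suc N) (suc (suc k))
        ≈⟨ absorption-suc N (suc k) ⟩
      [ + suc N ] * b′
        ≡⟨ ≡.cong (λ K → [ K ] * b′) top ⟨
      [ + suc k ℤ.+ (+ N ℤ.- + k) ] * b′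
        ≈⟨ *-congʳ ([+]-split (+ suc k) (+ N ℤ.- + k)) ⟨
      ([ + suc k ] + q^ (+ suc k) * [ + N ℤ.- + k ]) * b′
        ≈⟨ SS.solve 4 (λ s q t b → (s SS.:+ q SS.:* t) SS.:* b SS.:= s SS.:* b SS.:+ t SS.:* (q SS.:* b)) refl _ _ _ _ ⟩
      [ + suc k ] * b′ + [ + N ℤ.- + k ] * (q^ (+ suc k) * b′)
        ≈⟨ +-congʳ (absorption N k) ⟩
      [ + N ℤ.- + k ] * b + [ + N ℤ.- + k ] * (q^ (+ suc k) * b′)
        ≈⟨ distribˡ _ _ _ ⟨
      [ + N ℤ.- + k ] * (b + q^ (+ suc k) * b′)
        ≡⟨ ≡.cong (λ K → [ K ] * (b + q^ (+ suc k) * b′)) shift ⟨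
      [ + suc N ℤ.- + suc k ] * qBinomial (suc N) (suc k) ∎
      where
      b  = qBinomial N k
      b′ = qBinomial N (suc k)
      open +-*-Solver
      top : + suc k ℤ.+ (+ N ℤ.- + k) ≡ + suc N
      top = solve 2 (λ n k → (con (+ 1) :+ k) :+ (n :- k) := con (+ 1) :+ n) ≡.refl (+ N) (+ k)
      shift : + suc N ℤ.- + suc k ≡ + N ℤ.- + k
      shift = solve 2 (λ n k → (con (+ 1) :+ n) :- (con (+ 1) :+ k) := n :- k) ≡.refl (+ N) (+ k)

    absorption-suc : ∀ N k → [ + suc k ] * qBinomial (suc N) (suc k) ≈ [ + suc N ] * qBinomial N k
    absorption-suc N k = begin
      [ + suc k ] * (b + q^ (+ suc k) * b′)
        ≈⟨ SS.solve 4 (λ s q b c → s SS.:* (b SS.:+ q SS.:* c) SS.:= s SS.:* b SS.:+ q SS.:* (s SS.:* c)) refl _ _ _ _ ⟩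
      [ + suc k ] * b + q^ (+ suc k) * ([ + suc k ] * b′)
        ≈⟨ +-congˡ (*-congˡ (absorption N k)) ⟩
      [ + suc k ] * b + q^ (+ suc k) * ([ + N ℤ.- + k ] * b)
        ≈⟨ SS.solve 4 (λ s q t b → s SS.:* b SS.:+ q SS.:* (t SS.:* b) SS.:= (s SS.:+ q SS.:* t) SS.:* b) refl _ _ _ _ ⟩
      ([ + suc k ] + q^ (+ suc k) * [ + N ℤ.- + k ]) * b
        ≈⟨ *-congʳ ([+]-split (+ suc k) (+ N ℤ.- + k)) ⟩
      [ + suc k ℤ.+ (+ N ℤ.- + k) ] * b
        ≡⟨ ≡.cong (λ K → [ K ] * b) top ⟩
      [ + suc N ] * b ∎
      where
      b  = qBinomial N k
      b′ = qBinomial N (suc k)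
      open +-*-Solver
      top : + suc k ℤ.+ (+ N ℤ.- + k) ≡ + suc N
      top = solve 2 (λ n k → (con (+ 1) :+ k) :+ (n :- k) := con (+ 1) :+ n) ≡.refl (+ N) (+ k)

  absorption-upper : ∀ N k → [ + suc N ℤ.- + k ] * qBinomial (suc N) k ≈ [ + suc N ] * qBinomial N k
  absorption-upper N k = trans (sym (absorption (suc N) k)) (absorption-suc N k)

  -- The base of the α-th power in wCoefficient α (k + 1) (j + 1).
  wBase : ℕ → ℕ → Carrier
  wBase k j = qBinomial k j * qBinomial (suc k ℕ.+ suc j) (suc j)
            - qBinomial (suc k) (suc j) * qBinomial (suc k ℕ.+ suc j) j

  -- By absorption, `[ k + 2 ]` times the subtracted product is `[ k + 1 ]` times the first product,
  -- and `[ k + 2 ]` minus `[ k + 1 ]` is q^(k+1). This is the product formula for the coefficients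
  -- of w with its denominator cleared.
  [k+2]*wBase : ∀ k j → [ + suc (suc k) ] * wBase k j ≈
    q^ (+ suc k) * (qBinomial k j * qBinomial (suc k ℕ.+ suc j) (suc j))
  [k+2]*wBase k j = begin
    [ + suc (suc k) ] * (b * B - b′ * B′)
      ≈⟨ RP.x[y-z]≈xy-xz _ _ _ ⟩
    [ + suc (suc k) ] * (b * B) - [ + suc (suc k) ] * (b′ * B′)
      ≈⟨ +-congˡ (-‿cong second) ⟩
    [ + suc (suc k) ] * (b * B) - [ + suc k ] * (b * B)
      ≈⟨ +-congʳ (distribʳ _ _ _) ⟩
    ([ + suc k ] * (b * B) + q^ (+ suc k) * (b * B)) - [ + suc k ] * (b * B)
      ≈⟨ +-congʳ (+-comm _ _) ⟩
    (q^ (+ suc k) * (b * B) + [ + suc k ] * (b * B)) - [ + suc k ] * (b * B)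
      ≈⟨ trans (+-assoc _ _ _) (trans (+-congˡ (-‿inverseʳ _)) (+-identityʳ _)) ⟩
    q^ (+ suc k) * (b * B) ∎
    where
    b  = qBinomial k j
    B  = qBinomial (suc k ℕ.+ suc j) (suc j)
    b′ = qBinomial (suc k) (suc j)
    B′ = qBinomial (suc k ℕ.+ suc j) j
    top : + (suc k ℕ.+ suc j) ℤ.- + j ≡ + suc (suc k)
    top = solve 2 (λ k j → ((con (+ 1) :+ k) :+ (con (+ 1) :+ j)) :- j := con (+ 2) :+ k) ≡.refl (+ k) (+ j)
      where open +-*-Solver
    second : [ + suc (suc k) ] * (b′ * B′) ≈ [ + suc k ] * (b * B)
    second = begin
      [ + suc (suc k) ] * (b′ * B′)                     ≈⟨ x∙yz≈y∙xz _ _ _ ⟩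
      b′ * ([ + suc (suc k) ] * B′)                     ≡⟨ ≡.cong (λ K → b′ * ([ K ] * B′)) top ⟨
      b′ * ([ + (suc k ℕ.+ suc j) ℤ.- + j ] * B′)       ≈⟨ *-congˡ (absorption (suc k ℕ.+ suc j) j) ⟨
      b′ * ([ + suc j ] * B)                            ≈⟨ x∙yz≈y∙xz _ _ _ ⟩
      [ + suc j ] * (b′ * B)                            ≈⟨ *-assoc _ _ _ ⟨
      ([ + suc j ] * b′) * B                            ≈⟨ *-congʳ (absorption-suc k j) ⟩
      ([ + suc k ] * b) * B                             ≈⟨ *-assoc _ _ _ ⟩
      [ + suc k ] * (b * B)                             ∎

  -- The ratio of consecutive coefficients. In the product formula each of the two q-binomials
  -- contributes one q-integer to either side; the common factor `[ k + 2 ]` stays until it is known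
  -- to be cancellable.
  [k+2]*wBase-suc : ∀ k j →
    [ + suc (suc k) ] * ([ + suc j ] * [ + suc (suc j) ] * wBase k (suc j)) ≈
    [ + suc (suc k) ] * ([ + k ℤ.- + j ] * [ + suc (suc (k ℕ.+ suc j)) ] * wBase k j)
  [k+2]*wBase-suc k j = begin
    s * ([ + suc j ] * [ + suc (suc j) ] * wBase k (suc j))
      ≈⟨ x∙yz≈y∙xz _ _ _ ⟩
    [ + suc j ] * [ + suc (suc j) ] * (s * wBase k (suc j))
      ≈⟨ *-congˡ ([k+2]*wBase k (suc j)) ⟩
    [ + suc j ] * [ + suc (suc j) ] * (q^ (+ suc k) * (qBinomial k (suc j) * qBinomial (suc k ℕ.+ suc (suc j)) (suc (suc j))))
      ≈⟨ SS.solve 5 (λ x y q b c → x SS.:* y SS.:* (q SS.:* (b SS.:* c)) SS.:= q SS.:* ((x SS.:* b) SS.:* (y SS.:* c))) refl _ _ _ _ _ ⟩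
    q^ (+ suc k) * ([ + suc j ] * qBinomial k (suc j) * ([ + suc (suc j) ] * qBinomial (suc k ℕ.+ suc (suc j)) (suc (suc j))))
      ≡⟨ ≡.cong (λ N → q^ (+ suc k) * ([ + suc j ] * qBinomial k (suc j) * ([ + suc (suc j) ] * qBinomial N (suc (suc j))))) (ℕ.+-suc (suc k) (suc j)) ⟩
    q^ (+ suc k) * ([ + suc j ] * qBinomial k (suc j) * ([ + suc (suc j) ] * qBinomial (suc (suc k ℕ.+ suc j)) (suc (suc j))))
      ≈⟨ *-congˡ (*-cong (absorption k j) (absorption-suc (suc k ℕ.+ suc j) (suc j))) ⟩
    q^ (+ suc k) * ([ + k ℤ.- + j ] * qBinomial k j * ([ + suc (suc k ℕ.+ suc j) ] * qBinomial (suc k ℕ.+ suc j) (suc j)))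
      ≈⟨ SS.solve 5 (λ x y q b c → q SS.:* ((x SS.:* b) SS.:* (y SS.:* c)) SS.:= x SS.:* y SS.:* (q SS.:* (b SS.:* c))) refl _ _ _ _ _ ⟩
    [ + k ℤ.- + j ] * [ + suc (suc k ℕ.+ suc j) ] * (q^ (+ suc k) * (qBinomial k j * qBinomial (suc k ℕ.+ suc j) (suc j)))
      ≈⟨ *-congˡ ([k+2]*wBase k j) ⟨
    [ + k ℤ.- + j ] * [ + suc (suc k ℕ.+ suc j) ] * (s * wBase k j)
      ≈⟨ x∙yz≈y∙xz _ _ _ ⟩
    s * ([ + k ℤ.- + j ] * [ + suc (suc (k ℕ.+ suc j)) ] * wBase k j) ∎
    where s = [ + suc (suc k) ]

-- Sums over initial segments of the natural numbers.

module RangeSums {c ℓ : Level} (R : CommutativeRing c ℓ) where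

  open CommutativeRing R
  open CommutativeMonoidSum +-commutativeMonoid
    using (sum-syntax; sum-cong-≋; sum-permute; ∑-distrib-+; sum-replicate-zero)
  open SetoidReasoning setoid

  ∑<-cong : ∀ n {f g : ℕ → Carrier} → (∀ i → f i ≈ g i) →
    ∑[ i < n ] f (toℕ i) ≈ ∑[ i < n ] g (toℕ i)
  ∑<-cong n f≈g = sum-cong-≋ {n} (λ i → f≈g (toℕ i))

  ∑<-zero : ∀ n {f : Fin n → Carrier} → (∀ i → f i ≈ 0#) → ∑[ i < n ] f i ≈ 0#
  ∑<-zero n f≈0 = trans (sum-cong-≋ {n} f≈0) (sum-replicate-zero n)

  ∑<-split : ∀ m n (f : ℕ → Carrier) → ∑[ i < m ℕ.+ n ] f (toℕ i) ≈
    ∑[ i < m ] f (toℕ i) + ∑[ i < n ] f (m ℕ.+ toℕ i)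
  ∑<-split zero    n f = sym (+-identityˡ _)
  ∑<-split (suc m) n f = trans (+-congˡ (∑<-split m n (f ∘ suc))) (sym (+-assoc _ _ _))

  ∑<-extend : ∀ {m n} (f : ℕ → Carrier) → m ℕ.≤ n → (∀ i → m ℕ.≤ i → f i ≈ 0#) →
    ∑[ i < m ] f (toℕ i) ≈ ∑[ i < n ] f (toℕ i)
  ∑<-extend {m} f m≤n f≈0 with k , ≡.refl ← ℕ.m≤n⇒∃[o]m+o≡n m≤n = begin
    ∑[ i < m ] f (toℕ i)                                    ≈⟨ +-identityʳ _ ⟨
    ∑[ i < m ] f (toℕ i) + 0#                               ≈⟨ +-congˡ (∑<-zero k (λ i → f≈0 _ (ℕ.m≤m+n m (toℕ i)))) ⟨
    ∑[ i < m ] f (toℕ i) + ∑[ i < k ] f (m ℕ.+ toℕ i)       ≈⟨ ∑<-split m k f ⟨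
    ∑[ i < m ℕ.+ k ] f (toℕ i)                              ∎

  ∑<-blocks : ∀ t d (f : ℕ → Carrier) → (∀ a → ∑[ i < d ] f (toℕ i ℕ.+ a ℕ.* d) ≈ 0#) →
    ∑[ i < t ℕ.* d ] f (toℕ i) ≈ 0#
  ∑<-blocks zero    d f block≈0 = refl
  ∑<-blocks (suc t) d f block≈0 = begin
    ∑[ i < d ℕ.+ t ℕ.* d ] f (toℕ i)
      ≈⟨ ∑<-split d (t ℕ.* d) f ⟩
    ∑[ i < d ] f (toℕ i) + ∑[ i < t ℕ.* d ] f (d ℕ.+ toℕ i)
      ≈⟨ +-cong (∑<-cong d (λ i → reflexive (≡.cong f (≡.sym (ℕ.+-identityʳ i)))))
                (∑<-blocks t d (λ i → f (d ℕ.+ i)) λ a → trans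
                  (∑<-cong d (λ i → reflexive (≡.cong f (x+yz≡y+xz d i (a ℕ.* d)))))
                  (block≈0 (suc a))) ⟩
    ∑[ i < d ] f (toℕ i ℕ.+ 0) + 0#
      ≈⟨ trans (+-identityʳ _) (block≈0 0) ⟩
    0# ∎
    where open CommutativeSemigroupProperties ℕ.+-commutativeSemigroup renaming (x∙yz≈y∙xz to x+yz≡y+xz)

  -- The sum is added to its own reversal, so that every term of the result is zero. No choice of
  -- pairs is needed, and a fixed middle index causes no special case; in exchange, 2 has to be
  -- cancellable.
  ∑<-antisymmetric : (∀ {y} → y + y ≈ 0# → y ≈ 0#) → ∀ n (f : ℕ → Carrier) →
    (∀ i i′ → suc (i ℕ.+ i′) ≡ n → f i + f i′ ≈ 0#) → ∑[ i < n ] f (toℕ i) ≈ 0#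
  ∑<-antisymmetric halve n f anti = halve (begin
    ∑[ i < n ] f (toℕ i) + ∑[ i < n ] f (toℕ i)
      ≈⟨ +-congˡ (sum-permute (f ∘ toℕ) (reverse {n})) ⟩
    ∑[ i < n ] f (toℕ i) + ∑[ i < n ] f (toℕ (opposite i))
      ≈⟨ ∑-distrib-+ {n} (f ∘ toℕ) (f ∘ toℕ ∘ opposite) ⟨
    ∑[ i < n ] (f (toℕ i) + f (toℕ (opposite i)))
      ≈⟨ ∑<-zero n (λ i → anti (toℕ i) (toℕ (opposite i)) (mirror i)) ⟩
    0# ∎)
    where
    mirror : ∀ (i : Fin n) → suc (toℕ i ℕ.+ toℕ (opposite i)) ≡ n
    mirror i = ≡.trans (≡.cong (λ k → suc (toℕ i ℕ.+ k)) (Fin.opposite-prop i)) (ℕ.m+[n∸m]≡n (Fin.toℕ<n i))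

-- The summands, and the polynomials w with a power of q removed.

module Summands
  {c ℓ : Level} (R : CommutativeRing c ℓ)
  (q^_ : ℤ → CommutativeRing.Carrier R)
  (q^0≈1 : CommutativeRing._≈_ R (q^ (+ 0)) (CommutativeRing.1# R))
  (q^-homo : ∀ a b → CommutativeRing._≈_ R (CommutativeRing._*_ R (q^ a) (q^ b)) (q^ (a ℤ.+ b)))
  where

  open CommutativeRing R
  open QAnalogues R q^_ q^0≈1 q^-homo
  open QIdentities R q^_ q^0≈1 q^-homo
  open RangeSums R
  open SemiringSum semiring using (*-distribˡ-sum)
  open CommutativeMonoidSum +-commutativeMonoid using (sum-syntax)
  open Exponentiation commutativeSemiring using (_^_; ^-congˡ; ^-distrib-*)
  open SetoidReasoning setoid
  private
    module RP = RingProperties ring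
    module *-CS = CommutativeSemigroupProperties *-commutativeSemigroup
    module SS = SemiringSolver commutativeSemiring

  ^-vanishes : ∀ n .{{_ : NonZero n}} {y} → y ≈ 0# → y ^ n ≈ 0#
  ^-vanishes (suc n) y≈0 = trans (*-congʳ y≈0) (zeroˡ _)

  q^-^ : ∀ N n → (q^ N) ^ n ≈ q^ (+ n ℤ.* N)
  q^-^ N zero    = sym (trans (reflexive (≡.cong q^_ (ℤ.*-zeroˡ N))) q^0≈1)
  q^-^ N (suc n) = begin
    q^ N * (q^ N) ^ n         ≈⟨ *-congˡ (q^-^ N n) ⟩
    q^ N * q^ (+ n ℤ.* N)     ≈⟨ q^-homo _ _ ⟩
    q^ (N ℤ.+ + n ℤ.* N)      ≡⟨ ≡.cong q^_ (ℤ.suc-* (+ n) N) ⟨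
    q^ (+ suc n ℤ.* N)        ∎

  -- Stated over any ring with powers of q, because the cancellation takes place in quotients of the
  -- polynomial ring; `Transport` compares the versions.
  summand : (x : Carrier) (α m r n k : ℕ) → Carrier
  w : Carrier → ℕ → ℕ → Carrier
  w x α k = ∑[ i < k ] (wCoefficient α k (suc (toℕ i)) * x ^ toℕ i)
  summand x α m r n k =
    [ + (k ℕ.* (k ℕ.+ 2)) ] ^ r
    * [ + (2 ℕ.* (k ℕ.+ 1)) ]
    * q^ ((+ n ℤ.- + 2 ℤ.- + k) ℤ.* + (2 ℕ.* α ℕ.* m ℕ.+ 1))
    * (w x α k * w x α (k ℕ.+ 1)) ^ m

  -- The exponent is chosen to make this invariant under k + 1 ↦ - 1 - (k + 1)
  -- at a root of unity.
  reducedBase : ℕ → ℕ → Carrier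
  reducedBase k j = q^ (ℤ.- (+ suc (suc k) ℤ.* + j ℤ.+ + suc k)) * wBase k j

  -- The twist by a power of q adds the factor q^(-(k+2)) to the ratio of consecutive coefficients,
  -- which is what makes this ratio symmetric in `ratio-reflection`.
  reducedBase-suc : ∀ k j →
    [ + suc (suc k) ] * ([ + suc j ] * [ + suc (suc j) ] * reducedBase k (suc j)) ≈
    [ + suc (suc k) ] * (q^ (ℤ.- + suc (suc k)) * ([ + k ℤ.- + j ] * [ + suc (suc (k ℕ.+ suc j)) ]) * reducedBase k j)
  reducedBase-suc k j = begin
    s * ([ + suc j ] * [ + suc (suc j) ] * (q^ E′ * wBase k (suc j)))
      ≈⟨ SS.solve 5 (λ s a b e u → s SS.:* (a SS.:* b SS.:* (e SS.:* u)) SS.:= e SS.:* (s SS.:* (a SS.:* b SS.:* u))) refl _ _ _ _ _ ⟩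
    q^ E′ * (s * ([ + suc j ] * [ + suc (suc j) ] * wBase k (suc j)))
      ≈⟨ *-cong (reflexive (≡.cong q^_ exponent)) ([k+2]*wBase-suc k j) ⟩
    q^ (ℤ.- + suc (suc k) ℤ.+ E) * (s * (a * b * wBase k j))
      ≈⟨ *-congʳ (q^-homo _ _) ⟨
    q^ (ℤ.- + suc (suc k)) * q^ E * (s * (a * b * wBase k j))
      ≈⟨ SS.solve 6 (λ f e s a b u → f SS.:* e SS.:* (s SS.:* (a SS.:* b SS.:* u)) SS.:= s SS.:* (f SS.:* (a SS.:* b) SS.:* (e SS.:* u))) refl _ _ _ _ _ _ ⟩
    s * (q^ (ℤ.- + suc (suc k)) * (a * b) * (q^ E * wBase k j)) ∎
    where
    s = [ + suc (suc k) ]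
    a = [ + k ℤ.- + j ]
    b = [ + suc (suc (k ℕ.+ suc j)) ]
    E E′ : ℤ
    E  = ℤ.- (+ suc (suc k) ℤ.* + j ℤ.+ + suc k)
    E′ = ℤ.- (+ suc (suc k) ℤ.* + suc j ℤ.+ + suc k)
    exponent : E′ ≡ ℤ.- + suc (suc k) ℤ.+ E
    exponent = solve 2 (λ k j →
      :- ((con (+ 2) :+ k) :* (con (+ 1) :+ j) :+ (con (+ 1) :+ k)) :=
      :- (con (+ 2) :+ k) :+ :- ((con (+ 2) :+ k) :* j :+ (con (+ 1) :+ k))) ≡.refl (+ k) (+ j)
      where open +-*-Solver

  -- This is W at index k + 1. The number `M` of terms is independent of `k`, so that two reflected
  -- indices give sums over the same range; the terms with j > k are zero if α > 0 and k < M.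
  reducedW : Carrier → ℕ → ℕ → ℕ → Carrier
  reducedW x α M k = ∑[ i < M ] ((q^ (+ (suc (suc (toℕ i)) C 2)) * reducedBase k (toℕ i)) ^ α * x ^ toℕ i)

  -- The power of q is split in three: q^(α(k+1)), common to all j; the binomial exponent, free of
  -- k; and the twist inside `reducedBase`. Only the last one has to be respected by the reflection
  -- of k.
  wCoefficient-reduced : ∀ α k j → wCoefficient α (suc k) (suc j) ≈
    q^ (+ α ℤ.* + suc k) * (q^ (+ (suc (suc j) C 2)) * reducedBase k j) ^ α
  wCoefficient-reduced α k j = begin
    q^ (+ α ℤ.* N) * wBase k j ^ α
      ≈⟨ *-congʳ (q^-^ N α) ⟨
    (q^ N) ^ α * wBase k j ^ α
      ≈⟨ ^-distrib-* _ _ α ⟨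
    (q^ N * wBase k j) ^ α
      ≈⟨ ^-congˡ α (begin
        q^ N * wBase k j
          ≡⟨ ≡.cong (λ K → q^ K * wBase k j) exponent ⟩
        q^ (+ suc k ℤ.+ (C₂ ℤ.+ E)) * wBase k j
          ≈⟨ *-congʳ (trans (*-congˡ (q^-homo _ _)) (q^-homo _ _)) ⟨
        q^ (+ suc k) * (q^ C₂ * q^ E) * wBase k j
          ≈⟨ trans (*-assoc _ _ _) (*-congˡ (*-assoc _ _ _)) ⟩
        q^ (+ suc k) * (q^ C₂ * reducedBase k j) ∎) ⟩
    (q^ (+ suc k) * (q^ C₂ * reducedBase k j)) ^ α
      ≈⟨ ^-distrib-* _ _ α ⟩
    (q^ (+ suc k)) ^ α * (q^ C₂ * reducedBase k j) ^ α
      ≈⟨ *-congʳ (q^-^ (+ suc k) α) ⟩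
    q^ (+ α ℤ.* + suc k) * (q^ C₂ * reducedBase k j) ^ α ∎
    where
    C₂ E N : ℤ
    C₂ = + (suc (suc j) C 2)
    E  = ℤ.- (+ suc (suc k) ℤ.* + j ℤ.+ + suc k)
    N  = C₂ ℤ.- + (suc k ℕ.+ 1) ℤ.* (+ suc j ℤ.- + 1)
    exponent : N ≡ + suc k ℤ.+ (C₂ ℤ.+ E)
    exponent = solve 3 (λ k j c →
      c :- ((con (+ 1) :+ k) :+ con (+ 1)) :* ((con (+ 1) :+ j) :- con (+ 1)) :=
      (con (+ 1) :+ k) :+ (c :+ :- ((con (+ 2) :+ k) :* j :+ (con (+ 1) :+ k)))) ≡.refl (+ k) (+ j) C₂
      where open +-*-Solver

  reducedBase-vanishes : ∀ {k j} → k ℕ.< j → reducedBase k j ≈ 0#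
  reducedBase-vanishes {k} {j} k<j = trans (*-congˡ wBase≈0) (zeroʳ _)
    where
    wBase≈0 : wBase k j ≈ 0#
    wBase≈0 = begin
      wBase k j
        ≈⟨ +-cong (trans (*-congʳ (qBinomial-vanishes k<j)) (zeroˡ _))
                  (-‿cong (trans (*-congʳ (qBinomial-vanishes (s≤s k<j))) (zeroˡ _))) ⟩
      0# - 0#   ≈⟨ -‿inverseʳ 0# ⟩
      0#        ∎

  w-reduced : ∀ x α .{{_ : NonZero α}} {M} k → k ℕ.< M →
    w x α (suc k) ≈ q^ (+ α ℤ.* + suc k) * reducedW x α M k
  w-reduced x α {M} k k<M = begin
    w x α (suc k)
      ≈⟨ ∑<-cong (suc k) (λ i → trans (*-congʳ (wCoefficient-reduced α k i)) (*-assoc _ _ (x ^ i))) ⟩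
    ∑[ i < suc k ] (q^ (+ α ℤ.* + suc k) * f (toℕ i))
      ≈⟨ *-distribˡ-sum {suc k} _ (f ∘ toℕ) ⟨
    q^ (+ α ℤ.* + suc k) * ∑[ i < suc k ] f (toℕ i)
      -- The terms beyond k have base 0, and α > 0 makes their α-th powers 0 as well.
      ≈⟨ *-congˡ (∑<-extend f k<M λ i k<i → trans
           (*-congʳ (^-vanishes α (trans (*-congˡ (reducedBase-vanishes k<i)) (zeroʳ _))))
           (zeroˡ _)) ⟩
    q^ (+ α ℤ.* + suc k) * reducedW x α M k ∎
    where
    f : ℕ → Carrier
    f i = (q^ (+ (suc (suc i) C 2)) * reducedBase k i) ^ α * x ^ i

  -- The powers of q carried by the two polynomials shift the exponent of q in the
  -- summand to a constant minus k.
  summand-reduced : ∀ x α m r n k {P P′} →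
    w x α k ≈ q^ (+ α ℤ.* + k) * P → w x α (suc k) ≈ q^ (+ α ℤ.* + suc k) * P′ →
    summand x α m r n k ≈
    [ + (k ℕ.* (k ℕ.+ 2)) ] ^ r * q^ ((+ n ℤ.- + 2) ℤ.* (+ 2 ℤ.* + α ℤ.* + m ℤ.+ + 1) ℤ.+ + α ℤ.* + m) * (P * P′) ^ m
    * ([ + (2 ℕ.* (k ℕ.+ 1)) ] * q^ (ℤ.- + k))
  summand-reduced x α m r n k {P} {P′} w≈ w′≈ = begin
    A * B * q^ E * (w x α k * w x α (k ℕ.+ 1)) ^ m
      ≡⟨ ≡.cong (λ k′ → A * B * q^ E * (w x α k * w x α k′) ^ m) (ℕ.+-comm k 1) ⟩
    A * B * q^ E * (w x α k * w x α (suc k)) ^ m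
      ≈⟨ *-congˡ (^-congˡ m (trans (*-cong w≈ w′≈) (*-CS.interchange _ _ _ _))) ⟩
    A * B * q^ E * (q^ (+ α ℤ.* + k) * q^ (+ α ℤ.* + suc k) * (P * P′)) ^ m
      ≈⟨ *-congˡ (trans (^-distrib-* _ _ m) (*-congʳ (trans (^-congˡ m (q^-homo _ _)) (q^-^ _ m)))) ⟩
    A * B * q^ E * (q^ F * (P * P′) ^ m)
      ≈⟨ SS.solve 5 (λ a b e f p → a SS.:* b SS.:* e SS.:* (f SS.:* p) SS.:= a SS.:* (e SS.:* f) SS.:* p SS.:* b) refl _ _ _ _ _ ⟩
    A * (q^ E * q^ F) * (P * P′) ^ m * B
      ≈⟨ *-congʳ (*-congʳ (*-congˡ (trans (q^-homo _ _) (trans (reflexive (≡.cong q^_ exponent)) (sym (q^-homo _ _)))))) ⟩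
    A * (q^ G * q^ (ℤ.- + k)) * (P * P′) ^ m * B
      ≈⟨ SS.solve 5 (λ a b g h p → a SS.:* (g SS.:* h) SS.:* p SS.:* b SS.:= a SS.:* g SS.:* p SS.:* (b SS.:* h)) refl _ _ _ _ _ ⟩
    A * q^ G * (P * P′) ^ m * (B * q^ (ℤ.- + k)) ∎
    where
    A = [ + (k ℕ.* (k ℕ.+ 2)) ] ^ r
    B = [ + (2 ℕ.* (k ℕ.+ 1)) ]
    E F G : ℤ
    E = (+ n ℤ.- + 2 ℤ.- + k) ℤ.* + (2 ℕ.* α ℕ.* m ℕ.+ 1)
    F = + m ℤ.* (+ α ℤ.* + k ℤ.+ + α ℤ.* + suc k)
    G = (+ n ℤ.- + 2) ℤ.* (+ 2 ℤ.* + α ℤ.* + m ℤ.+ + 1) ℤ.+ + α ℤ.* + m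
    cast : + (2 ℕ.* α ℕ.* m ℕ.+ 1) ≡ + 2 ℤ.* + α ℤ.* + m ℤ.+ + 1
    cast = ≡.cong (ℤ._+ + 1) (≡.trans (ℤ.pos-* (2 ℕ.* α) m) (≡.cong (ℤ._* + m) (ℤ.pos-* 2 α)))
    exponent : E ℤ.+ F ≡ G ℤ.+ ℤ.- + k
    exponent = ≡.trans (≡.cong (λ K → (+ n ℤ.- + 2 ℤ.- + k) ℤ.* K ℤ.+ F) cast)
      (solve 4 (λ n k a m →
        (n :- con (+ 2) :- k) :* (con (+ 2) :* a :* m :+ con (+ 1)) :+ m :* (a :* k :+ a :* (con (+ 1) :+ k)) :=
        (n :- con (+ 2)) :* (con (+ 2) :* a :* m :+ con (+ 1)) :+ a :* m :+ :- k) ≡.refl (+ n) (+ k) (+ α) (+ m))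
      where open +-*-Solver

  -- Reflection and cancellation at a primitive d-th root of unity, given by three properties.

  module AtRootOfUnity
    (d : ℕ)
    ([d]≈0 : [ + d ] ≈ 0#)
    ([]-cancel : ∀ {k} → 0 ℕ.< k → k ℕ.< d → ∀ {y} → [ + k ] * y ≈ 0# → y ≈ 0#)
    (halve : ∀ {y} → y + y ≈ 0# → y ≈ 0#)
    where

    [multiple]≈0 : ∀ t → [ + (t ℕ.* d) ] ≈ 0#
    [multiple]≈0 zero    = refl
    [multiple]≈0 (suc t) = begin
      [ + d ℤ.+ + (t ℕ.* d) ]               ≈⟨ [+]-split (+ d) (+ (t ℕ.* d)) ⟨
      [ + d ] + q^ (+ d) * [ + (t ℕ.* d) ]  ≈⟨ +-cong [d]≈0 (*-congˡ ([multiple]≈0 t)) ⟩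
      0# + q^ (+ d) * 0#                    ≈⟨ trans (+-identityˡ _) (zeroʳ _) ⟩
      0#                                    ∎

    q^-periodic : ∀ t N → q^ (N ℤ.+ + (t ℕ.* d)) ≈ q^ N
    q^-periodic t N = begin
      q^ (N ℤ.+ + (t ℕ.* d))      ≈⟨ q^-homo N _ ⟨
      q^ N * q^ (+ (t ℕ.* d))     ≈⟨ *-congˡ (RP.x∙y⁻¹≈ε⇒x≈y _ _ q^-1≈0) ⟨
      q^ N * 1#                   ≈⟨ *-identityʳ _ ⟩
      q^ N                        ∎
      where
      q^-1≈0 : 1# - q^ (+ (t ℕ.* d)) ≈ 0#
      q^-1≈0 = trans (sym (RawMagma._∣ʳ_.equality (1-q∣1-q^ (+ (t ℕ.* d)))))
        (trans (*-congʳ ([multiple]≈0 t)) (zeroˡ _))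

    []-periodic : ∀ t N → [ N ℤ.+ + (t ℕ.* d) ] ≈ [ N ]
    []-periodic t N = begin
      [ N ℤ.+ + (t ℕ.* d) ]              ≈⟨ [+]-split N _ ⟨
      [ N ] + q^ N * [ + (t ℕ.* d) ]     ≈⟨ +-congˡ (trans (*-congˡ ([multiple]≈0 t)) (zeroʳ _)) ⟩
      [ N ] + 0#                         ≈⟨ +-identityʳ _ ⟩
      [ N ]                              ∎

    cancel : ∀ {r} a → 0 ℕ.< r → r ℕ.< d → ∀ {y z} →
      [ + (r ℕ.+ a ℕ.* d) ] * y ≈ [ + (r ℕ.+ a ℕ.* d) ] * z → y ≈ z
    cancel {r} a 0<r r<d {y} {z} eq = RP.x∙y⁻¹≈ε⇒x≈y _ _ ([]-cancel 0<r r<d (begin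
      [ + r ] * (y - z)                       ≈⟨ *-congʳ ([]-periodic a (+ r)) ⟨
      [ + (r ℕ.+ a ℕ.* d) ] * (y - z)         ≈⟨ RP.x[y-z]≈xy-xz _ _ _ ⟩
      [ + (r ℕ.+ a ℕ.* d) ] * y - [ + (r ℕ.+ a ℕ.* d) ] * z
                                              ≈⟨ +-congʳ eq ⟩
      [ + (r ℕ.+ a ℕ.* d) ] * z - [ + (r ℕ.+ a ℕ.* d) ] * z
                                              ≈⟨ -‿inverseʳ _ ⟩
      0#                                      ∎))

    cancel-0 : ∀ {r} a → 0 ℕ.< r → r ℕ.< d → ∀ {y} → [ + (r ℕ.+ a ℕ.* d) ] * y ≈ 0# → y ≈ 0#
    cancel-0 a 0<r r<d eq = cancel a 0<r r<d (trans eq (sym (zeroʳ _)))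

    -- A case of the q-Lucas theorem. Since c d counts as 0, both q-integers in `absorption-upper`
    -- become `[ N + 1 ]`, which is cancellable as long as N + 1 stays inside the block.
    qBinomial-block : ∀ a c {b} → b ℕ.< d → qBinomial (b ℕ.+ a ℕ.* d) (c ℕ.* d) ≈ qBinomial (a ℕ.* d) (c ℕ.* d)
    qBinomial-block a c {zero}  _   = refl
    qBinomial-block a c {suc b} b<d = trans (cancel a ℕ.z<s b<d (begin
      [ + suc N ] * qBinomial (suc N) (c ℕ.* d)
        ≡⟨ ≡.cong (λ K → [ K ] * qBinomial (suc N) (c ℕ.* d)) shift ⟨
      [ (+ suc N ℤ.- + (c ℕ.* d)) ℤ.+ + (c ℕ.* d) ] * qBinomial (suc N) (c ℕ.* d)
        ≈⟨ *-congʳ ([]-periodic c (+ suc N ℤ.- + (c ℕ.* d))) ⟩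
      [ + suc N ℤ.- + (c ℕ.* d) ] * qBinomial (suc N) (c ℕ.* d)
        ≈⟨ absorption-upper N (c ℕ.* d) ⟩
      [ + suc N ] * qBinomial N (c ℕ.* d) ∎))
      (qBinomial-block a c (ℕ.<-trans (ℕ.n<1+n b) b<d))
      where
      N = b ℕ.+ a ℕ.* d
      shift : (+ suc N ℤ.- + (c ℕ.* d)) ℤ.+ + (c ℕ.* d) ≡ + suc N
      shift = solve 2 (λ n c → n :- c :+ c := n) ≡.refl (+ suc N) (+ (c ℕ.* d))
        where open +-*-Solver

    -- If d divides j + 1, absorption gives `[ k + 1 ]` times `qBinomial k j` equal to 0; neither k
    -- + 1 nor k + 2 is a multiple of d, so their q-integers cancel. This settles the last j of each
    -- block.
    wBase-multiple : ∀ a {b} → suc (suc b) ℕ.< d → ∀ {j} c → suc j ≡ c ℕ.* d → wBase (b ℕ.+ a ℕ.* d) j ≈ 0#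
    wBase-multiple a {b} b+2<d {j} c 1+j≡cd = cancel-0 a ℕ.z<s b+2<d (begin
      [ + suc (suc k) ] * wBase k j
        ≈⟨ [k+2]*wBase k j ⟩
      q^ (+ suc k) * (qBinomial k j * qBinomial (suc k ℕ.+ suc j) (suc j))
        ≈⟨ *-congˡ (trans (*-congʳ vanishes) (zeroˡ _)) ⟩
      q^ (+ suc k) * 0#
        ≈⟨ zeroʳ _ ⟩
      0# ∎)
      where
      k = b ℕ.+ a ℕ.* d
      vanishes : qBinomial k j ≈ 0#
      vanishes = cancel-0 a ℕ.z<s (ℕ.<-trans (ℕ.n<1+n _) b+2<d) (begin
        [ + suc k ] * qBinomial k j                       ≈⟨ absorption-suc k j ⟨
        [ + suc j ] * qBinomial (suc k) (suc j)           ≡⟨ ≡.cong (λ i → [ + i ] * qBinomial (suc k) (suc j)) 1+j≡cd ⟩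
        [ + (c ℕ.* d) ] * qBinomial (suc k) (suc j)       ≈⟨ trans (*-congʳ ([multiple]≈0 c)) (zeroˡ _) ⟩
        0#                                                ∎)

    -- At a multiple j of d the value does not depend on the position `b` within the block. This is
    -- the starting value for the recursion in j, which cannot cross a multiple of d.
    reducedBase-block : ∀ a {b} → suc (suc b) ℕ.< d → ∀ c →
      reducedBase (b ℕ.+ a ℕ.* d) (c ℕ.* d) ≈
      qBinomial (a ℕ.* d) (c ℕ.* d) * qBinomial ((a ℕ.+ c) ℕ.* d) (c ℕ.* d)
    reducedBase-block a {b} b+2<d c = begin
      q^ E * wBase k j
        ≈⟨ *-congˡ (cancel a ℕ.z<s b+2<d scaled) ⟩
      q^ E * (q^ (+ suc k) * (qBinomial k j * qBinomial (suc k ℕ.+ j) j))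
        ≈⟨ *-assoc _ _ _ ⟨
      q^ E * q^ (+ suc k) * (qBinomial k j * qBinomial (suc k ℕ.+ j) j)
        ≈⟨ *-cong power (*-cong (qBinomial-block a c b<d) second) ⟩
      1# * (qBinomial (a ℕ.* d) j * qBinomial ((a ℕ.+ c) ℕ.* d) j)
        ≈⟨ *-identityˡ _ ⟩
      qBinomial (a ℕ.* d) j * qBinomial ((a ℕ.+ c) ℕ.* d) j ∎
      where
      k = b ℕ.+ a ℕ.* d
      j = c ℕ.* d
      b+1<d = ℕ.<-trans (ℕ.n<1+n (suc b)) b+2<d
      b<d = ℕ.<-trans (ℕ.n<1+n b) b+1<d
      E : ℤ
      E = ℤ.- (+ suc (suc k) ℤ.* + j ℤ.+ + suc k)
      power : q^ E * q^ (+ suc k) ≈ 1#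
      power = begin
        q^ E * q^ (+ suc k)
          ≈⟨ q^-homo _ _ ⟩
        q^ (E ℤ.+ + suc k)
          ≈⟨ q^-periodic (suc (suc k) ℕ.* c) _ ⟨
        q^ (E ℤ.+ + suc k ℤ.+ + (suc (suc k) ℕ.* c ℕ.* d))
          ≡⟨ ≡.cong q^_ exponent ⟩
        q^ (+ 0)
          ≈⟨ q^0≈1 ⟩
        1# ∎
        where
        exponent : E ℤ.+ + suc k ℤ.+ + (suc (suc k) ℕ.* c ℕ.* d) ≡ + 0
        exponent = ≡.trans
          (≡.cong (λ K → E ℤ.+ + suc k ℤ.+ K)
            (≡.trans (≡.cong +_ (ℕ.*-assoc (suc (suc k)) c d)) (ℤ.pos-* (suc (suc k)) j)))
          (solve 2 (λ k j → :- ((con (+ 1) :+ k) :* j :+ k) :+ k :+ (con (+ 1) :+ k) :* j := con (+ 0)) ≡.refl (+ suc k) (+ j))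
          where open +-*-Solver
      -- As d divides j, absorption at j + 1 involves no proper denominator.
      [1+j]≈1 : [ + suc j ] ≈ 1#
      [1+j]≈1 = trans ([]-periodic c (+ 1)) [1]≈1
      upper : qBinomial (suc k ℕ.+ suc j) (suc j) ≈ [ + suc (suc k) ] * qBinomial (suc k ℕ.+ j) j
      upper = begin
        qBinomial (suc k ℕ.+ suc j) (suc j)
          ≡⟨ ≡.cong (λ N → qBinomial N (suc j)) (ℕ.+-suc (suc k) j) ⟩
        qBinomial (suc (suc k ℕ.+ j)) (suc j)
          ≈⟨ trans (*-congʳ [1+j]≈1) (*-identityˡ _) ⟨
        [ + suc j ] * qBinomial (suc (suc k ℕ.+ j)) (suc j)
          ≈⟨ absorption-suc (suc k ℕ.+ j) j ⟩
        [ + suc (suc k) ℤ.+ + j ] * qBinomial (suc k ℕ.+ j) j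
          ≈⟨ *-congʳ ([]-periodic c (+ suc (suc k))) ⟩
        [ + suc (suc k) ] * qBinomial (suc k ℕ.+ j) j ∎
      scaled : [ + suc (suc k) ] * wBase k j ≈
               [ + suc (suc k) ] * (q^ (+ suc k) * (qBinomial k j * qBinomial (suc k ℕ.+ j) j))
      scaled = begin
        [ + suc (suc k) ] * wBase k j
          ≈⟨ [k+2]*wBase k j ⟩
        q^ (+ suc k) * (qBinomial k j * qBinomial (suc k ℕ.+ suc j) (suc j))
          ≈⟨ *-congˡ (*-congˡ upper) ⟩
        q^ (+ suc k) * (qBinomial k j * ([ + suc (suc k) ] * qBinomial (suc k ℕ.+ j) j))
          ≈⟨ SS.solve 4 (λ q b s c → q SS.:* (b SS.:* (s SS.:* c)) SS.:= s SS.:* (q SS.:* (b SS.:* c))) refl _ _ _ _ ⟩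
        [ + suc (suc k) ] * (q^ (+ suc k) * (qBinomial k j * qBinomial (suc k ℕ.+ j) j)) ∎
      second : qBinomial (suc k ℕ.+ j) j ≈ qBinomial ((a ℕ.+ c) ℕ.* d) j
      second = trans (reflexive (≡.cong (λ N → qBinomial N j) regroup)) (qBinomial-block (a ℕ.+ c) c b+1<d)
        where
        regroup : suc k ℕ.+ j ≡ suc b ℕ.+ (a ℕ.+ c) ℕ.* d
        regroup = ≡.cong suc (≡.trans (ℕ.+-assoc b (a ℕ.* d) (c ℕ.* d))
          (≡.cong (b ℕ.+_) (≡.sym (ℕ.*-distribʳ-+ d a c))))

    -- Here k + k′ + 3 is a multiple of d, so k′ - j is congruent to -(k + j + 3), and k′ + j + 3 to
    -- -(k - j). The two q-integers are exchanged, their signs cancel, and the powers of q coming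
    -- from `[-]` combine with the prefactor.
    ratio-reflection : ∀ a {b b′} → 3 ℕ.+ b ℕ.+ b′ ≡ d → ∀ j → let k = b ℕ.+ a ℕ.* d; k′ = b′ ℕ.+ a ℕ.* d in
      q^ (ℤ.- + suc (suc k)) * ([ + k ℤ.- + j ] * [ + suc (suc (k ℕ.+ suc j)) ]) ≈
      q^ (ℤ.- + suc (suc k′)) * ([ + k′ ℤ.- + j ] * [ + suc (suc (k′ ℕ.+ suc j)) ])
    ratio-reflection a {b} {b′} 3+b+b′≡d j = sym (begin
      q^ (ℤ.- + suc (suc k′)) * ([ + k′ ℤ.- + j ] * [ + suc (suc (k′ ℕ.+ suc j)) ])
        ≈⟨ *-cong (sym (transfer q^_ q^-periodic (ℤ.- + suc (suc k′)) (+ suc k) first))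
            (*-cong (trans (transfer [_] []-periodic (ℤ.- t) (+ k′ ℤ.- + j) second) ([-] t))
                    (trans (transfer [_] []-periodic (ℤ.- s) (+ suc (suc (k′ ℕ.+ suc j))) third) ([-] s))) ⟩
      q^ (+ suc k) * (- (q^ (ℤ.- t) * [ t ]) * - (q^ (ℤ.- s) * [ s ]))
        ≈⟨ *-congˡ (-x*-y≈x*y _ _) ⟩
      q^ (+ suc k) * (q^ (ℤ.- t) * [ t ] * (q^ (ℤ.- s) * [ s ]))
        ≈⟨ SS.solve 5 (λ p q r a b → p SS.:* (q SS.:* a SS.:* (r SS.:* b)) SS.:= p SS.:* (q SS.:* r) SS.:* (b SS.:* a)) refl _ _ _ _ _ ⟩
      q^ (+ suc k) * (q^ (ℤ.- t) * q^ (ℤ.- s)) * ([ s ] * [ t ])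
        ≈⟨ *-congʳ (trans (*-congˡ (q^-homo _ _)) (q^-homo _ _)) ⟩
      q^ (+ suc k ℤ.+ (ℤ.- t ℤ.+ ℤ.- s)) * ([ s ] * [ t ])
        ≡⟨ ≡.cong (λ K → q^ K * ([ s ] * [ t ])) exponent ⟩
      q^ (ℤ.- + suc (suc k)) * ([ s ] * [ t ]) ∎)
      where
      k k′ : ℕ
      k  = b ℕ.+ a ℕ.* d
      k′ = b′ ℕ.+ a ℕ.* d
      s t D : ℤ
      s = + k ℤ.- + j
      t = + suc (suc (k ℕ.+ suc j))
      D = + (suc (2 ℕ.* a) ℕ.* d)
      -x*-y≈x*y : ∀ x y → - x * - y ≈ x * y
      -x*-y≈x*y x y = trans (sym (RP.-‿distribˡ-* x (- y)))
        (trans (-‿cong (sym (RP.-‿distribʳ-* x y))) (RP.-‿involutive _))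
      sum : + 3 ℤ.+ + k ℤ.+ + k′ ≡ D
      sum = ≡.cong +_ (≡.trans
        (solve 3 (λ b b′ e → con 3 :+ (b :+ e) :+ (b′ :+ e) := (con 3 :+ b :+ b′) :+ con 2 :* e) ≡.refl b b′ (a ℕ.* d))
        (≡.cong₂ ℕ._+_ 3+b+b′≡d (≡.sym (ℕ.*-assoc 2 a d))))
        where open ℕSolver.+-*-Solver
      transfer : (f : ℤ → Carrier) → (∀ t N → f (N ℤ.+ + (t ℕ.* d)) ≈ f N) →
        ∀ M N → N ≡ M ℤ.+ (+ 3 ℤ.+ + k ℤ.+ + k′) → f N ≈ f M
      transfer f periodic M N eq = trans
        (reflexive (≡.cong f (≡.trans eq (≡.cong (λ K → M ℤ.+ K) sum)))) (periodic (suc (2 ℕ.* a)) M)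
      open +-*-Solver
      first : + suc k ≡ ℤ.- + suc (suc k′) ℤ.+ (+ 3 ℤ.+ + k ℤ.+ + k′)
      first = solve 2 (λ k k′ → con (+ 1) :+ k := :- (con (+ 2) :+ k′) :+ (con (+ 3) :+ k :+ k′)) ≡.refl (+ k) (+ k′)
      second : + k′ ℤ.- + j ≡ ℤ.- t ℤ.+ (+ 3 ℤ.+ + k ℤ.+ + k′)
      second = solve 3 (λ k k′ j → k′ :- j := :- (con (+ 2) :+ (k :+ (con (+ 1) :+ j))) :+ (con (+ 3) :+ k :+ k′)) ≡.refl (+ k) (+ k′) (+ j)
      third : + suc (suc (k′ ℕ.+ suc j)) ≡ ℤ.- s ℤ.+ (+ 3 ℤ.+ + k ℤ.+ + k′)
      third = solve 3 (λ k k′ j → (con (+ 2) :+ (k′ :+ (con (+ 1) :+ j))) := :- (k :- j) :+ (con (+ 3) :+ k :+ k′)) ≡.refl (+ k) (+ k′) (+ j)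
      exponent : + suc k ℤ.+ (ℤ.- t ℤ.+ ℤ.- s) ≡ ℤ.- + suc (suc k)
      exponent = solve 2 (λ k j → (con (+ 1) :+ k) :+ (:- (con (+ 2) :+ (k :+ (con (+ 1) :+ j))) :+ :- (k :- j)) := :- (con (+ 2) :+ k)) ≡.refl (+ k) (+ j)

    -- Induction on the remainder `e` of j modulo d. The values agree at remainder 0 by
    -- `reducedBase-block`, and the ratio recursion carries this on. The last remainder d - 1 would
    -- require dividing by the q-integer of a multiple of d, but there both sides are 0.
    reducedBase-reflection : ∀ a {b b′} → 3 ℕ.+ b ℕ.+ b′ ≡ d → ∀ c {e} → e ℕ.< d →
      reducedBase (b ℕ.+ a ℕ.* d) (e ℕ.+ c ℕ.* d) ≈ reducedBase (b′ ℕ.+ a ℕ.* d) (e ℕ.+ c ℕ.* d)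
    reducedBase-reflection a {b} {b′} 3+b+b′≡d c {e} e<d = by-remainder e e<d
      where
      k k′ : ℕ
      k  = b ℕ.+ a ℕ.* d
      k′ = b′ ℕ.+ a ℕ.* d
      b+2<d : 2 ℕ.+ b ℕ.< d
      b+2<d = ℕ.≤-trans (ℕ.m≤m+n (3 ℕ.+ b) b′) (ℕ.≤-reflexive 3+b+b′≡d)
      b′+2<d : 2 ℕ.+ b′ ℕ.< d
      b′+2<d = ℕ.≤-trans (ℕ.m≤m+n (3 ℕ.+ b′) b)
        (ℕ.≤-reflexive (≡.trans (≡.cong (3 ℕ.+_) (ℕ.+-comm b′ b)) 3+b+b′≡d))
      ratio : ℕ → ℕ → Carrier
      ratio k j = q^ (ℤ.- + suc (suc k)) * ([ + k ℤ.- + j ] * [ + suc (suc (k ℕ.+ suc j)) ])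
      step : ∀ {b} → 2 ℕ.+ b ℕ.< d → ∀ j → [ + suc j ] * [ + suc (suc j) ] * reducedBase (b ℕ.+ a ℕ.* d) (suc j) ≈
        ratio (b ℕ.+ a ℕ.* d) j * reducedBase (b ℕ.+ a ℕ.* d) j
      step b+2<d j = cancel a ℕ.z<s b+2<d (reducedBase-suc _ j)
      vanishes : ∀ {b} → 2 ℕ.+ b ℕ.< d → ∀ {e} → suc e ≡ d → reducedBase (b ℕ.+ a ℕ.* d) (e ℕ.+ c ℕ.* d) ≈ 0#
      vanishes b+2<d 1+e≡d = trans
        (*-congˡ (wBase-multiple a b+2<d (suc c) (≡.cong (ℕ._+ c ℕ.* d) 1+e≡d))) (zeroʳ _)
      by-remainder : ∀ e → e ℕ.< d → reducedBase k (e ℕ.+ c ℕ.* d) ≈ reducedBase k′ (e ℕ.+ c ℕ.* d)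
      by-remainder zero    _     = trans (reducedBase-block a b+2<d c) (sym (reducedBase-block a b′+2<d c))
      by-remainder (suc e) 1+e<d with ℕ.m≤n⇒m<n∨m≡n 1+e<d
      ... | inj₂ 2+e≡d = trans (vanishes b+2<d 2+e≡d) (sym (vanishes b′+2<d 2+e≡d))
      ... | inj₁ 2+e<d = cancel c ℕ.z<s 2+e<d (cancel c ℕ.z<s 1+e<d (begin
        [ + suc j ] * ([ + suc (suc j) ] * reducedBase k (suc j))     ≈⟨ *-assoc _ _ _ ⟨
        [ + suc j ] * [ + suc (suc j) ] * reducedBase k (suc j)       ≈⟨ step b+2<d j ⟩
        ratio k j * reducedBase k j
          ≈⟨ *-cong (ratio-reflection a 3+b+b′≡d j) (by-remainder e (ℕ.<-trans (ℕ.n<1+n e) 1+e<d)) ⟩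
        ratio k′ j * reducedBase k′ j                                 ≈⟨ step b′+2<d j ⟨
        [ + suc j ] * [ + suc (suc j) ] * reducedBase k′ (suc j)      ≈⟨ *-assoc _ _ _ ⟩
        [ + suc j ] * ([ + suc (suc j) ] * reducedBase k′ (suc j))    ∎))
        where j = e ℕ.+ c ℕ.* d

    -- The polynomials compared are W at k + 1 and k′ + 1, so that indices adding up to -1 modulo d
    -- appear as `3 + b + b′ ≡ d`.
    reducedW-reflection : ∀ x α M a {b b′} → 3 ℕ.+ b ℕ.+ b′ ≡ d →
      reducedW x α M (b ℕ.+ a ℕ.* d) ≈ reducedW x α M (b′ ℕ.+ a ℕ.* d)
    reducedW-reflection x α M a {b} {b′} 3+b+b′≡d = ∑<-cong M λ j →
      *-congʳ {x ^ j} (^-congˡ α (*-congˡ {q^ (+ (suc (suc j) C 2))} (reflect j)))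
      where
      instance
        d≢0 : NonZero d
        d≢0 = ℕ.>-nonZero (ℕ.≤-trans (ℕ.z<s {2 ℕ.+ b ℕ.+ b′}) (ℕ.≤-reflexive 3+b+b′≡d))
      reflect : ∀ j → reducedBase (b ℕ.+ a ℕ.* d) j ≈ reducedBase (b′ ℕ.+ a ℕ.* d) j
      reflect j = ≡.subst (λ j → reducedBase (b ℕ.+ a ℕ.* d) j ≈ reducedBase (b′ ℕ.+ a ℕ.* d) j)
        (≡.sym (m≡m%n+[m/n]*n j d)) (reducedBase-reflection a 3+b+b′≡d (j / d) (m%n<n j d))

    module _ (x : Carrier) (α m r n : ℕ) .{{_ : NonZero α}} .{{_ : NonZero r}} where

      summand-vanishes : ∀ k t → k ℕ.* (k ℕ.+ 2) ≡ t ℕ.* d → summand x α m r n k ≈ 0#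
      summand-vanishes k t eq = trans (*-congʳ (trans (*-congʳ (trans (*-congʳ
        (^-vanishes r (trans (reflexive (≡.cong (λ N → [ + N ]) eq)) ([multiple]≈0 t))))
        (zeroˡ _))) (zeroˡ _))) (zeroˡ _)

      summand-vanishes-0 : ∀ k t → k ≡ t ℕ.* d → summand x α m r n k ≈ 0#
      summand-vanishes-0 k t k≡td = summand-vanishes k ((k ℕ.+ 2) ℕ.* t)
        (≡.trans (ℕ.*-comm k (k ℕ.+ 2))
          (≡.trans (≡.cong ((k ℕ.+ 2) ℕ.*_) k≡td) (≡.sym (ℕ.*-assoc (k ℕ.+ 2) t d))))

      summand-vanishes-1 : ∀ k t → k ℕ.+ 1 ≡ t ℕ.* d → summand x α m r n k ≈ 0#
      summand-vanishes-1 k t k+1≡td = trans (*-congʳ (trans (*-congʳ (trans (*-congˡ (trans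
        (reflexive (≡.cong (λ N → [ + N ]) (≡.trans (≡.cong (2 ℕ.*_) k+1≡td) (≡.sym (ℕ.*-assoc 2 t d)))))
        ([multiple]≈0 (2 ℕ.* t)))) (zeroʳ _))) (zeroˡ _))) (zeroˡ _)

      summand-vanishes-2 : ∀ k t → k ℕ.+ 2 ≡ t ℕ.* d → summand x α m r n k ≈ 0#
      summand-vanishes-2 k t k+2≡td = summand-vanishes k (k ℕ.* t)
        (≡.trans (≡.cong (k ℕ.*_) k+2≡td) (≡.sym (ℕ.*-assoc k t d)))

      -- Reflection turns W at k into W at k′ + 1 and W at k + 1 into W at k′, which leaves their
      -- product unchanged. The factor `[ k (k + 2) ]` is unchanged too, while `[ 2 (k + 1) ]` times
      -- q^(-k) changes its sign.
      summand-antisymmetric : ∀ a {b b′} → 4 ℕ.+ b ℕ.+ b′ ≡ d →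
        summand x α m r n (suc b ℕ.+ a ℕ.* d) + summand x α m r n (suc b′ ℕ.+ a ℕ.* d) ≈ 0#
      summand-antisymmetric a {b} {b′} 4+b+b′≡d = begin
        summand x α m r n k + summand x α m r n k′
          ≈⟨ +-cong (summand-reduced x α m r n k
                      (w-reduced x α k₁ (ℕ.m<n⇒m<1+n k₁<M)) (w-reduced x α k (s≤s k₁<M)))
                    (summand-reduced x α m r n k′
                      (w-reduced x α k₁′ (ℕ.m<n⇒m<1+n k₁′<M)) (w-reduced x α k′ (s≤s k₁′<M))) ⟩
        [ + (k ℕ.* (k ℕ.+ 2)) ] ^ r * q^ G * (W k₁ * W k) ^ m * ([ + (2 ℕ.* (k ℕ.+ 1)) ] * q^ (ℤ.- + k))
        + [ + (k′ ℕ.* (k′ ℕ.+ 2)) ] ^ r * q^ G * (W k₁′ * W k′) ^ m * ([ + (2 ℕ.* (k′ ℕ.+ 1)) ] * q^ (ℤ.- + k′))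
          ≈⟨ +-congˡ (*-cong (*-cong (*-congʳ (^-congˡ r (sym squares)))
                                     (^-congˡ m (trans (*-cong (sym W-k) (sym W-k₁)) (*-comm _ _))))
                             odd) ⟩
        A * B + A * - B
          ≈⟨ distribˡ _ _ _ ⟨
        A * (B - B)
          ≈⟨ trans (*-congˡ (-‿inverseʳ B)) (zeroʳ A) ⟩
        0# ∎
        where
        k₁ k₁′ k k′ M : ℕ
        k₁  = b ℕ.+ a ℕ.* d
        k₁′ = b′ ℕ.+ a ℕ.* d
        k   = suc k₁
        k′  = suc k₁′
        M   = suc (suc (k₁ ℕ.+ k₁′))
        k₁<M : k₁ ℕ.< suc (k₁ ℕ.+ k₁′)
        k₁<M = s≤s (ℕ.m≤m+n k₁ k₁′)
        k₁′<M : k₁′ ℕ.< suc (k₁ ℕ.+ k₁′)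
        k₁′<M = s≤s (ℕ.m≤n+m k₁′ k₁)
        W : ℕ → Carrier
        W = reducedW x α M
        W-k₁ : W k₁ ≈ W k′
        W-k₁ = reducedW-reflection x α M a (≡.trans (ℕ.+-suc (3 ℕ.+ b) b′) 4+b+b′≡d)
        W-k : W k ≈ W k₁′
        W-k = reducedW-reflection x α M a 4+b+b′≡d
        G : ℤ
        G = (+ n ℤ.- + 2) ℤ.* (+ 2 ℤ.* + α ℤ.* + m ℤ.+ + 1) ℤ.+ + α ℤ.* + m
        A B : Carrier
        A = [ + (k ℕ.* (k ℕ.+ 2)) ] ^ r * q^ G * (W k₁ * W k) ^ m
        B = [ + (2 ℕ.* (k ℕ.+ 1)) ] * q^ (ℤ.- + k)
        t : ℕ
        t = suc (2 ℕ.* a)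
        sum : k ℕ.+ k′ ℕ.+ 2 ≡ t ℕ.* d
        sum = ≡.trans
          (solve 3 (λ b b′ e → (con 1 :+ (b :+ e)) :+ (con 1 :+ (b′ :+ e)) :+ con 2 := (con 4 :+ b :+ b′) :+ con 2 :* e) ≡.refl b b′ (a ℕ.* d))
          (≡.cong₂ ℕ._+_ 4+b+b′≡d (≡.sym (ℕ.*-assoc 2 a d)))
          where open ℕSolver.+-*-Solver
        -- The arguments differ by (k - k′)(k + k′ + 2), a multiple of d; adding k′ t d to one and k
        -- t d to the other avoids subtraction.
        squares : [ + (k ℕ.* (k ℕ.+ 2)) ] ≈ [ + (k′ ℕ.* (k′ ℕ.+ 2)) ]
        squares = begin
          [ + (k ℕ.* (k ℕ.+ 2)) ]
            ≈⟨ []-periodic (k′ ℕ.* t) (+ (k ℕ.* (k ℕ.+ 2))) ⟨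
          [ + (k ℕ.* (k ℕ.+ 2) ℕ.+ k′ ℕ.* t ℕ.* d) ]
            ≡⟨ ≡.cong (λ N → [ + N ]) balance ⟩
          [ + (k′ ℕ.* (k′ ℕ.+ 2) ℕ.+ k ℕ.* t ℕ.* d) ]
            ≈⟨ []-periodic (k ℕ.* t) (+ (k′ ℕ.* (k′ ℕ.+ 2))) ⟩
          [ + (k′ ℕ.* (k′ ℕ.+ 2)) ] ∎
          where
          balance : k ℕ.* (k ℕ.+ 2) ℕ.+ k′ ℕ.* t ℕ.* d ≡ k′ ℕ.* (k′ ℕ.+ 2) ℕ.+ k ℕ.* t ℕ.* d
          balance rewrite ℕ.*-assoc k′ t d | ℕ.*-assoc k t d | ≡.sym sum =
            solve 2 (λ k k′ → k :* (k :+ con 2) :+ k′ :* (k :+ k′ :+ con 2) := k′ :* (k′ :+ con 2) :+ k :* (k :+ k′ :+ con 2)) ≡.refl k k′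
            where open ℕSolver.+-*-Solver
        -- Modulo d, 2(k′ + 1) is congruent to -2(k + 1), and -k′ to k + 2. The q-integer of the
        -- negative yields the sign and q^(-2(k+1)), which together with q^(k+2) leaves q^(-k).
        odd : [ + (2 ℕ.* (k′ ℕ.+ 1)) ] * q^ (ℤ.- + k′) ≈ - B
        odd = begin
          [ + (2 ℕ.* (k′ ℕ.+ 1)) ] * q^ (ℤ.- + k′)
            ≈⟨ *-cong reflected shifted ⟩
          - (q^ (ℤ.- N) * [ N ]) * q^ (+ k ℤ.+ + 2)
            ≈⟨ RP.-‿distribˡ-* _ _ ⟨
          - (q^ (ℤ.- N) * [ N ] * q^ (+ k ℤ.+ + 2))
            ≈⟨ -‿cong (SS.solve 3 (λ p s q → p SS.:* s SS.:* q SS.:= s SS.:* (p SS.:* q)) refl _ _ _) ⟩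
          - ([ N ] * (q^ (ℤ.- N) * q^ (+ k ℤ.+ + 2)))
            ≈⟨ -‿cong (*-congˡ (trans (q^-homo _ _) (reflexive (≡.cong q^_ exponent)))) ⟩
          - B ∎
          where
          N D : ℤ
          N = + (2 ℕ.* (k ℕ.+ 1))
          D = + (t ℕ.* d)
          N≡ : N ≡ + 2 ℤ.* (+ k ℤ.+ + 1)
          N≡ = ℤ.pos-* 2 (k ℕ.+ 1)
          reflected : [ + (2 ℕ.* (k′ ℕ.+ 1)) ] ≈ - (q^ (ℤ.- N) * [ N ])
          reflected = begin
            [ + (2 ℕ.* (k′ ℕ.+ 1)) ]                        ≡⟨ ≡.cong [_] shift ⟩
            [ ℤ.- N ℤ.+ + (2 ℕ.* t ℕ.* d) ]                 ≈⟨ []-periodic (2 ℕ.* t) (ℤ.- N) ⟩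
            [ ℤ.- N ]                                       ≈⟨ [-] N ⟩
            - (q^ (ℤ.- N) * [ N ])                          ∎
            where
            shift : + (2 ℕ.* (k′ ℕ.+ 1)) ≡ ℤ.- N ℤ.+ + (2 ℕ.* t ℕ.* d)
            shift rewrite N≡ | ℤ.pos-* 2 (k′ ℕ.+ 1) | ℕ.*-assoc 2 t d | ≡.sym sum | ℤ.pos-* 2 (k ℕ.+ k′ ℕ.+ 2) =
              solve 2 (λ k k′ → con (+ 2) :* (k′ :+ con (+ 1)) := :- (con (+ 2) :* (k :+ con (+ 1))) :+ con (+ 2) :* (k :+ k′ :+ con (+ 2))) ≡.refl (+ k) (+ k′)
              where open +-*-Solver
          shifted : q^ (ℤ.- + k′) ≈ q^ (+ k ℤ.+ + 2)
          shifted = begin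
            q^ (ℤ.- + k′)           ≈⟨ q^-periodic t (ℤ.- + k′) ⟨
            q^ (ℤ.- + k′ ℤ.+ D)     ≡⟨ ≡.cong (λ K → q^ (ℤ.- + k′ ℤ.+ + K)) sum ⟨
            q^ (ℤ.- + k′ ℤ.+ (+ k ℤ.+ + k′ ℤ.+ + 2))
                                    ≡⟨ ≡.cong q^_ (solve 2 (λ k k′ → :- k′ :+ (k :+ k′ :+ con (+ 2)) := k :+ con (+ 2)) ≡.refl (+ k) (+ k′)) ⟩
            q^ (+ k ℤ.+ + 2)        ∎
            where open +-*-Solver
          exponent : ℤ.- N ℤ.+ (+ k ℤ.+ + 2) ≡ ℤ.- + k
          exponent rewrite N≡ = solve 1 (λ k → :- (con (+ 2) :* (k :+ con (+ 1))) :+ (k :+ con (+ 2)) := :- k) ≡.refl (+ k)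
            where open +-*-Solver

      -- The term at position d - 1 of the block is zero by itself. The other positions are paired
      -- by i + i′ = d - 2: position 0 meets d - 2, both terms being zero, and all remaining pairs
      -- cancel.
      summand-block : .{{_ : NonZero d}} → ∀ a → ∑[ i < d ] summand x α m r n (toℕ i ℕ.+ a ℕ.* d) ≈ 0#
      summand-block a = ≡.subst (λ D → ∑[ i < D ] f (toℕ i) ≈ 0#) d-1+1≡d (begin
        ∑[ i < d-1 ℕ.+ 1 ] f (toℕ i)
          ≈⟨ ∑<-split d-1 1 f ⟩
        ∑[ i < d-1 ] f (toℕ i) + (f (d-1 ℕ.+ 0) + 0#)
          ≈⟨ +-cong (∑<-antisymmetric halve d-1 f anti) (trans (+-identityʳ _) last) ⟩
        0# + 0#
          ≈⟨ +-identityˡ _ ⟩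
        0# ∎)
        where
        f : ℕ → Carrier
        f i = summand x α m r n (i ℕ.+ a ℕ.* d)
        d-1 : ℕ
        d-1 = ℕ.pred d
        d-1+1≡d : d-1 ℕ.+ 1 ≡ d
        d-1+1≡d = ≡.trans (ℕ.+-comm d-1 1) (ℕ.suc-pred d)
        last : f (d-1 ℕ.+ 0) ≈ 0#
        last = summand-vanishes-1 _ (suc a) (≡.trans
          (solve 2 (λ p e → p :+ con 0 :+ e :+ con 1 := (p :+ con 1) :+ e) ≡.refl d-1 (a ℕ.* d))
          (≡.cong (ℕ._+ a ℕ.* d) d-1+1≡d))
          where open ℕSolver.+-*-Solver
        first : f 0 ≈ 0#
        first = summand-vanishes-0 _ a ≡.refl
        penultimate : ∀ i → suc i ≡ d-1 → f i ≈ 0#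
        penultimate i 1+i≡d-1 = summand-vanishes-2 _ (suc a) (≡.trans
          (solve 2 (λ i e → i :+ e :+ con 2 := (con 1 :+ i :+ con 1) :+ e) ≡.refl i (a ℕ.* d))
          (≡.cong (ℕ._+ a ℕ.* d) (≡.trans (≡.cong (ℕ._+ 1) 1+i≡d-1) d-1+1≡d)))
          where open ℕSolver.+-*-Solver
        anti : ∀ i i′ → suc (i ℕ.+ i′) ≡ d-1 → f i + f i′ ≈ 0#
        anti zero    i′      eq = trans (+-cong first (penultimate i′ eq)) (+-identityˡ 0#)
        anti (suc i) zero    eq = trans
          (+-cong (penultimate (suc i) (≡.trans (≡.cong (λ i → suc (suc i)) (≡.sym (ℕ.+-identityʳ i))) eq)) first)
          (+-identityˡ 0#)
        anti (suc i) (suc i′) eq = summand-antisymmetric a (≡.trans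
          (solve 2 (λ i i′ → con 4 :+ i :+ i′ := con 1 :+ ((con 1 :+ i) :+ (con 1 :+ i′)) :+ con 1) ≡.refl i i′)
          (≡.trans (≡.cong (ℕ._+ 1) eq) d-1+1≡d))
          where open ℕSolver.+-*-Solver

      ∑-summand : .{{_ : NonZero d}} → ∀ t → ∑[ i < t ℕ.* d ] summand x α m r n (toℕ i) ≈ 0#
      ∑-summand t = ∑<-blocks t d (summand x α m r n) summand-block

-- Quotient of a commutative ring by an ideal, with the same carrier and a coarser equality.

module IdealQuotient
  {c ℓ p : Level} (R : CommutativeRing c ℓ)
  (I : CommutativeRing.Carrier R → Set p)
  (I-resp : ∀ {x y} → CommutativeRing._≈_ R x y → I x → I y)
  (I-0 : I (CommutativeRing.0# R))
  (I-+ : ∀ {x y} → I x → I y → I (CommutativeRing._+_ R x y))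
  (I-* : ∀ x {y} → I y → I (CommutativeRing._*_ R x y))
  where

  open CommutativeRing R
  open SetoidReasoning setoid
  private
    module RP = RingProperties ring
    module +-CS = CommutativeSemigroupProperties +-commutativeSemigroup

  infix 4 _≈ᴵ_
  record _≈ᴵ_ (x y : Carrier) : Set p where
    constructor mk≈ᴵ
    field
      difference : I (x - y)
  open _≈ᴵ_ public

  ≈⇒≈ᴵ : ∀ {x y} → x ≈ y → x ≈ᴵ y
  ≈⇒≈ᴵ x≈y = mk≈ᴵ (I-resp (sym (RP.x≈y⇒x∙y⁻¹≈ε x≈y)) I-0)

  private
    -1*[x-y] : ∀ x y → - 1# * (x - y) ≈ y - x
    -1*[x-y] x y = trans (RP.-1*x≈-x _) (RP.⁻¹-anti-homo‿- x y)

    symᴵ : ∀ {x y} → x ≈ᴵ y → y ≈ᴵ x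
    symᴵ {x} {y} (mk≈ᴵ i) = mk≈ᴵ (I-resp (-1*[x-y] x y) (I-* (- 1#) i))

    transᴵ : ∀ {x y z} → x ≈ᴵ y → y ≈ᴵ z → x ≈ᴵ z
    transᴵ {x} {y} {z} (mk≈ᴵ i) (mk≈ᴵ j) = mk≈ᴵ (I-resp (begin
      (x - y) + (y - z)        ≈⟨ +-assoc _ _ _ ⟩
      x + (- y + (y - z))      ≈⟨ +-congˡ (+-assoc _ _ _) ⟨
      x + ((- y + y) - z)      ≈⟨ +-congˡ (trans (+-congʳ (-‿inverseˡ y)) (+-identityˡ _)) ⟩
      x - z                    ∎) (I-+ i j))

    +-congᴵ : ∀ {x y u v} → x ≈ᴵ y → u ≈ᴵ v → x + u ≈ᴵ y + v
    +-congᴵ {x} {y} {u} {v} (mk≈ᴵ i) (mk≈ᴵ j) = mk≈ᴵ (I-resp (begin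
      (x - y) + (u - v)        ≈⟨ +-CS.interchange _ _ _ _ ⟩
      (x + u) + (- y + - v)    ≈⟨ +-congˡ (RP.-‿+-comm y v) ⟩
      (x + u) - (y + v)        ∎) (I-+ i j))

    *-congᴵ : ∀ {x y u v} → x ≈ᴵ y → u ≈ᴵ v → x * u ≈ᴵ y * v
    *-congᴵ {x} {y} {u} {v} (mk≈ᴵ i) (mk≈ᴵ j) = transᴵ
      (mk≈ᴵ (I-resp (trans (RP.x[y-z]≈xy-xz u x y) (+-cong (*-comm u x) (-‿cong (*-comm u y)))) (I-* u i)))
      (mk≈ᴵ (I-resp (RP.x[y-z]≈xy-xz y u v) (I-* y j)))

    -‿congᴵ : ∀ {x y} → x ≈ᴵ y → - x ≈ᴵ - y
    -‿congᴵ {x} {y} x≈y = transᴵ (≈⇒≈ᴵ (sym (RP.-1*x≈-x x)))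
      (transᴵ (*-congᴵ (≈⇒≈ᴵ refl) x≈y) (≈⇒≈ᴵ (RP.-1*x≈-x y)))

  R/I : CommutativeRing c p
  R/I = record
    { Carrier = Carrier
    ; _≈_     = _≈ᴵ_
    ; _+_     = _+_
    ; _*_     = _*_
    ; -_      = -_
    ; 0#      = 0#
    ; 1#      = 1#
    ; isCommutativeRing = record
      { isRing = record
        { +-isAbelianGroup = record
          { isGroup = record
            { isMonoid = record
              { isSemigroup = record
                { isMagma = record
                  { isEquivalence = record { refl = ≈⇒≈ᴵ refl ; sym = symᴵ ; trans = transᴵ }
                  ; ∙-cong = +-congᴵ
                  }
                ; assoc = λ x y z → ≈⇒≈ᴵ (+-assoc x y z)
                }
              ; identity = (λ x → ≈⇒≈ᴵ (+-identityˡ x)) , (λ x → ≈⇒≈ᴵ (+-identityʳ x))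
              }
            ; inverse = (λ x → ≈⇒≈ᴵ (-‿inverseˡ x)) , (λ x → ≈⇒≈ᴵ (-‿inverseʳ x))
            ; ⁻¹-cong = -‿congᴵ
            }
          ; comm = λ x y → ≈⇒≈ᴵ (+-comm x y)
          }
        ; *-cong     = *-congᴵ
        ; *-assoc    = λ x y z → ≈⇒≈ᴵ (*-assoc x y z)
        ; *-identity = (λ x → ≈⇒≈ᴵ (*-identityˡ x)) , (λ x → ≈⇒≈ᴵ (*-identityʳ x))
        ; distrib    = (λ x y z → ≈⇒≈ᴵ (distribˡ x y z)) , (λ x y z → ≈⇒≈ᴵ (distribʳ x y z))
        }
      ; *-comm = λ x y → ≈⇒≈ᴵ (*-comm x y)
      }
    }

  ≈ᴵ0⇒I : ∀ {x} → x ≈ᴵ 0# → I x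
  ≈ᴵ0⇒I {x} (mk≈ᴵ i) = I-resp (trans (+-congˡ RP.-0#≈0#) (+-identityʳ x)) i

  I⇒≈ᴵ0 : ∀ {x} → I x → x ≈ᴵ 0#
  I⇒≈ᴵ0 {x} i = mk≈ᴵ (I-resp (sym (trans (+-congˡ RP.-0#≈0#) (+-identityʳ x))) i)

  open RingMorphisms rawRing (CommutativeRing.rawRing R/I)

  id-isRingHomomorphism : IsRingHomomorphism id
  id-isRingHomomorphism = record
    { isSemiringHomomorphism = record
      { isNearSemiringHomomorphism = record
        { +-isMonoidHomomorphism = record
          { isMagmaHomomorphism = record
            { isRelHomomorphism = record { cong = ≈⇒≈ᴵ }
            ; homo = λ x y → ≈⇒≈ᴵ refl
            }
          ; ε-homo = ≈⇒≈ᴵ refl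
          }
        ; *-homo = λ x y → ≈⇒≈ᴵ refl
        }
      ; 1#-homo = ≈⇒≈ᴵ refl
      }
    ; -‿homo = λ x → ≈⇒≈ᴵ refl
    }

-- Compatibility of the q-analogues with ring homomorphisms.

module Transport
  {c ℓ c′ ℓ′ : Level} (R : CommutativeRing c ℓ) (R′ : CommutativeRing c′ ℓ′)
  (φ : CommutativeRing.Carrier R → CommutativeRing.Carrier R′)
  (φ-hom : RingMorphisms.IsRingHomomorphism (CommutativeRing.rawRing R) (CommutativeRing.rawRing R′) φ)
  (q^_ : ℤ → CommutativeRing.Carrier R)
  (q^0≈1 : CommutativeRing._≈_ R (q^ (+ 0)) (CommutativeRing.1# R))
  (q^-homo : ∀ a b → CommutativeRing._≈_ R (CommutativeRing._*_ R (q^ a) (q^ b)) (q^ (a ℤ.+ b)))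
  where

  private
    module R  = CommutativeRing R
    module R′ = CommutativeRing R′
  open RingMorphisms.IsRingHomomorphism φ-hom
  open Exponentiation R.commutativeSemiring using (_^_)
  open Exponentiation R′.commutativeSemiring using (^-congˡ) renaming (_^_ to _^′_)
  open CommutativeMonoidSum R.+-commutativeMonoid using (sum)
  open CommutativeMonoidSum R′.+-commutativeMonoid using (sum-cong-≋) renaming (sum to sum′)

  φq^0≈1 : φ (q^ (+ 0)) R′.≈ R′.1#
  φq^0≈1 = R′.trans (⟦⟧-cong q^0≈1) 1#-homo

  φq^-homo : ∀ a b → φ (q^ a) R′.* φ (q^ b) R′.≈ φ (q^ (a ℤ.+ b))
  φq^-homo a b = R′.trans (R′.sym (*-homo _ _)) (⟦⟧-cong (q^-homo a b))

  open QAnalogues R q^_ q^0≈1 q^-homo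
  open QAnalogues R′ (φ ∘ q^_) φq^0≈1 φq^-homo using ()
    renaming ([_] to [_]′; qBinomial to qBinomial′; wCoefficient to wCoefficient′)
  open Summands R q^_ q^0≈1 q^-homo using (w; summand)
  open Summands R′ (φ ∘ q^_) φq^0≈1 φq^-homo using () renaming (w to w′; summand to summand′)

  -- In a general ring a quotient is not unique, so φ need not respect it. But the quotient behind
  -- `[ N ]` is a concrete geometric sum, preserved term by term; `φ-qBinomial` uses the q-Pascal
  -- rule in the same way.
  φ-[] : ∀ N → φ [ N ] R′.≈ [ N ]′
  φ-[] (+ zero)     = 0#-homo
  φ-[] (+ suc n)    = R′.trans (+-homo _ _) (R′.+-congʳ (φ-[] (+ n)))
  φ-[] -[1+ zero ]  = -‿homo _
  φ-[] -[1+ suc n ] = R′.trans (+-homo _ _) (R′.+-cong (φ-[] -[1+ n ]) (-‿homo _))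

  φ-qBinomial : ∀ N k → φ (qBinomial N k) R′.≈ qBinomial′ N k
  φ-qBinomial N       zero    = 1#-homo
  φ-qBinomial zero    (suc k) = 0#-homo
  φ-qBinomial (suc N) (suc k) = R′.trans (+-homo _ _)
    (R′.+-cong (φ-qBinomial N k) (R′.trans (*-homo _ _) (R′.*-congˡ (φ-qBinomial N (suc k)))))

  φ-^ : ∀ y n → φ (y ^ n) R′.≈ φ y ^′ n
  φ-^ y zero    = 1#-homo
  φ-^ y (suc n) = R′.trans (*-homo _ _) (R′.*-congˡ (φ-^ y n))

  φ-^-cong : ∀ {y y′} n → φ y R′.≈ y′ → φ (y ^ n) R′.≈ y′ ^′ n
  φ-^-cong n φy≈y′ = R′.trans (φ-^ _ n) (^-congˡ n φy≈y′)

  φ-* : ∀ {y z y′ z′} → φ y R′.≈ y′ → φ z R′.≈ z′ → φ (y R.* z) R′.≈ y′ R′.* z′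
  φ-* φy≈y′ φz≈z′ = R′.trans (*-homo _ _) (R′.*-cong φy≈y′ φz≈z′)

  φ-∑ : ∀ n (f : Fin n → R.Carrier) → φ (sum f) R′.≈ sum′ (φ ∘ f)
  φ-∑ zero    f = 0#-homo
  φ-∑ (suc n) f = R′.trans (+-homo _ _) (R′.+-congˡ (φ-∑ n (f ∘ suc)))

  φ-wCoefficient : ∀ α k j → φ (wCoefficient α k j) R′.≈ wCoefficient′ α k j
  φ-wCoefficient α k j = φ-* R′.refl (φ-^-cong α (R′.trans (+-homo _ _) (R′.+-cong
    (φ-* (φ-qBinomial (k ℕ.∸ 1) (j ℕ.∸ 1)) (φ-qBinomial (k ℕ.+ j) j))
    (R′.trans (-‿homo _) (R′.-‿cong (φ-* (φ-qBinomial k j) (φ-qBinomial (k ℕ.+ j) (j ℕ.∸ 1))))))))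

  φ-w : ∀ x α k → φ (w x α k) R′.≈ w′ (φ x) α k
  φ-w x α k = R′.trans (φ-∑ k _) (sum-cong-≋ {k} λ i →
    φ-* (φ-wCoefficient α k (suc (toℕ i))) (φ-^ x (toℕ i)))

  φ-summand : ∀ x α m r n k → φ (summand x α m r n k) R′.≈ summand′ (φ x) α m r n k
  φ-summand x α m r n k =
    φ-* (φ-* (φ-* (φ-^-cong r (φ-[] (+ (k ℕ.* (k ℕ.+ 2))))) (φ-[] (+ (2 ℕ.* (k ℕ.+ 1))))) R′.refl)
        (φ-^-cong m (φ-* (φ-w x α k) (φ-w x α (k ℕ.+ 1))))

-- From vanishing at all divisors d of n to divisibility by the q-integer of n.

module CyclotomicDescent
  {c ℓ : Level} (R : CommutativeRing c ℓ)
  (q^_ : ℤ → CommutativeRing.Carrier R)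
  (q^0≈1 : CommutativeRing._≈_ R (q^ (+ 0)) (CommutativeRing.1# R))
  (q^-homo : ∀ a b → CommutativeRing._≈_ R (CommutativeRing._*_ R (q^ a) (q^ b)) (q^ (a ℤ.+ b)))
  where

  open CommutativeRing R
  open QAnalogues R q^_ q^0≈1 q^-homo
  open SemiringDivisibility semiring using (_∣_; _,_; ∣ʳ-respʳ-≈; _∣0)
  open CommutativeSemigroupDivisibility *-commutativeSemigroup using (x∣ʳy⇒x∣ʳzy)
  open Multiples semiring using (×-congʳ; ×-assoc-*) renaming (_×_ to _×ᴿ_)
  open Summands R q^_ q^0≈1 q^-homo using (summand)
  open CommutativeMonoidSum +-commutativeMonoid using (sum-syntax)
  open SetoidReasoning setoid
  private
    module RP = RingProperties ring
    module SS = SemiringSolver commutativeSemiring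
    module *-CS = CommutativeSemigroupProperties *-commutativeSemigroup

  ∣-+ : ∀ {x y z} → x ∣ y → x ∣ z → x ∣ y + z
  ∣-+ (u , ux≈y) (v , vx≈z) = u + v , trans (distribʳ _ _ _) (+-cong ux≈y vx≈z)

  ∣-- : ∀ {x y z} → x ∣ y + z → x ∣ z → x ∣ y
  ∣-- {x} {y} {z} x∣y+z x∣z = ∣ʳ-respʳ-≈
    (begin
      (y + z) + - 1# * z   ≈⟨ +-congˡ (RP.-1*x≈-x z) ⟩
      (y + z) - z          ≈⟨ +-assoc _ _ _ ⟩
      y + (z - z)          ≈⟨ trans (+-congˡ (-‿inverseʳ z)) (+-identityʳ y) ⟩
      y                    ∎)
    (∣-+ x∣y+z (x∣ʳy⇒x∣ʳzy (- 1#) x∣z))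

  -- [t g] is (1 + q^g + ⋯ + q^((t-1)g)) [g], and modulo [g] every summand of the
  -- first factor is 1.
  []-factor : ∀ t g → ∃[ h ] ∃[ s ] ([ + (t ℕ.* g) ] ≈ h * [ + g ] × t ×ᴿ 1# ≈ h + s * [ + g ])
  []-factor zero    g = 0# , 0# , sym (zeroˡ _) , sym (trans (+-identityˡ _) (zeroˡ _))
  []-factor (suc t) g with h , s , [tg]≈ , t≈ ← []-factor t g =
    1# + q^ (+ g) * h , s + h * (1# - q^ (+ 1)) , factor , residue
    where
    p = 1# - q^ (+ 1)
    one : 1# ≈ q^ (+ g) + [ + g ] * p
    one = sym (begin
      q^ (+ g) + [ + g ] * p         ≈⟨ +-congˡ (RawMagma._∣ʳ_.equality (1-q∣1-q^ (+ g))) ⟩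
      q^ (+ g) + (1# - q^ (+ g))     ≈⟨ +-comm _ _ ⟩
      (1# - q^ (+ g)) + q^ (+ g)     ≈⟨ +-assoc _ _ _ ⟩
      1# + (- q^ (+ g) + q^ (+ g))   ≈⟨ trans (+-congˡ (-‿inverseˡ _)) (+-identityʳ 1#) ⟩
      1#                             ∎)
    factor : [ + (g ℕ.+ t ℕ.* g) ] ≈ (1# + q^ (+ g) * h) * [ + g ]
    factor = begin
      [ + g ℤ.+ + (t ℕ.* g) ]                   ≈⟨ [+]-split (+ g) (+ (t ℕ.* g)) ⟨
      [ + g ] + q^ (+ g) * [ + (t ℕ.* g) ]      ≈⟨ +-congˡ (*-congˡ [tg]≈) ⟩
      [ + g ] + q^ (+ g) * (h * [ + g ])
        ≈⟨ SS.solve 3 (λ g q h → g SS.:+ q SS.:* (h SS.:* g) SS.:= (SS.con 1 SS.:+ q SS.:* h) SS.:* g) refl _ _ _ ⟩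
      (1# + q^ (+ g) * h) * [ + g ]             ∎
    residue : 1# + t ×ᴿ 1# ≈ (1# + q^ (+ g) * h) + (s + h * p) * [ + g ]
    residue = begin
      1# + t ×ᴿ 1#
        ≈⟨ +-congˡ (trans t≈ (+-congʳ (trans (sym (*-identityʳ h)) (*-congˡ one)))) ⟩
      1# + (h * (q^ (+ g) + [ + g ] * p) + s * [ + g ])
        ≈⟨ SS.solve 5 (λ h q g p s → SS.con 1 SS.:+ (h SS.:* (q SS.:+ g SS.:* p) SS.:+ s SS.:* g)
             SS.:= (SS.con 1 SS.:+ q SS.:* h) SS.:+ (s SS.:+ h SS.:* p) SS.:* g) refl _ _ _ _ _ ⟩
      (1# + q^ (+ g) * h) + (s + h * p) * [ + g ] ∎

  -- Let h be the cofactor of `[ g ]` in `[ t g ]`, so that t = h + s `[ g ]`. With y = y′ `[ g ]`,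
  -- the element h y = y′ `[ t g ]` is divisible by `[ t g ]`, and so is s `[ g ]` y by assumption;
  -- their sum is t y.
  gcd-step : ∀ t g {y} → [ + g ] ∣ y → [ + (t ℕ.* g) ] ∣ [ + g ] * y → [ + (t ℕ.* g) ] ∣ t ×ᴿ y
  gcd-step t g {y} (y′ , y′g≈y) n∣gy with h , s , [tg]≈ , t≈ ← []-factor t g = ∣ʳ-respʳ-≈
    (begin
      y′ * [ + (t ℕ.* g) ] + s * ([ + g ] * y)
        ≈⟨ +-congʳ (trans (*-congˡ [tg]≈) (trans (*-CS.x∙yz≈y∙xz _ _ _) (*-congˡ y′g≈y))) ⟩
      h * y + s * ([ + g ] * y)
        ≈⟨ SS.solve 4 (λ h y s g → h SS.:* y SS.:+ s SS.:* (g SS.:* y) SS.:= (h SS.:+ s SS.:* g) SS.:* y) refl _ _ _ _ ⟩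
      (h + s * [ + g ]) * y
        ≈⟨ *-congʳ t≈ ⟨
      (t ×ᴿ 1#) * y
        ≈⟨ ×-assoc-* t 1# y ⟩
      t ×ᴿ (1# * y)
        ≈⟨ ×-congʳ t (*-identityˡ y) ⟩
      t ×ᴿ y ∎)
    (∣-+ (x∣ʳy⇒x∣ʳzy y′ (1# , *-identityˡ _)) (x∣ʳy⇒x∣ʳzy s n∣gy))

  ∣-*ʳ : ∀ z {x y} → x ∣ y → x ∣ y * z
  ∣-*ʳ z x∣y = ∣ʳ-respʳ-≈ (*-comm z _) (x∣ʳy⇒x∣ʳzy z x∣y)

  []-∣-multiple : ∀ t g → [ + g ] ∣ [ + (t ℕ.* g) ]
  []-∣-multiple t g with h , _ , [tg]≈ , _ ← []-factor t g = h , sym [tg]≈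

  []-∣-difference : ∀ n {y} g M → [ + n ] ∣ [ + (g ℕ.+ M) ] * y → [ + n ] ∣ [ + M ] * y → [ + n ] ∣ [ + g ] * y
  []-∣-difference n {y} g M n∣N n∣M = ∣-- (∣ʳ-respʳ-≈ (begin
    [ + g ℤ.+ + M ] * y                       ≈⟨ *-congʳ ([+]-split (+ g) (+ M)) ⟨
    ([ + g ] + q^ (+ g) * [ + M ]) * y        ≈⟨ distribʳ _ _ _ ⟩
    [ + g ] * y + q^ (+ g) * [ + M ] * y      ≈⟨ +-congˡ (*-assoc _ _ _) ⟩
    [ + g ] * y + q^ (+ g) * ([ + M ] * y)    ∎) n∣N) (x∣ʳy⇒x∣ʳzy (q^ (+ g)) n∣M)

  -- By Bézout, the gcd is the difference of a multiple of k and a multiple of n, in one order or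
  -- the other. The q-integers of both multiples send y into the multiples of `[ n ]`, and the
  -- addition rule for q-integers passes this on to the difference.
  []-∣-gcd : ∀ k n {y} → [ + n ] ∣ [ + k ] * y → [ + n ] ∣ [ + gcd k n ] * y
  []-∣-gcd k n {y} n∣ky = bézout (Bézout.identity (gcd-GCD k n))
    where
    multiple-n : ∀ v → [ + n ] ∣ [ + (v ℕ.* n) ] * y
    multiple-n v = ∣-*ʳ y ([]-∣-multiple v n)
    multiple-k : ∀ u → [ + n ] ∣ [ + (u ℕ.* k) ] * y
    multiple-k u with h , hk≈uk ← []-∣-multiple u k =
      ∣ʳ-respʳ-≈ (trans (sym (*-assoc _ _ _)) (*-congʳ hk≈uk)) (x∣ʳy⇒x∣ʳzy h n∣ky)
    bézout : Bézout.Identity.Identity (gcd k n) k n → [ + n ] ∣ [ + gcd k n ] * y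
    bézout (Bézout.Identity.+- u v eq) = []-∣-difference n (gcd k n) (v ℕ.* n)
      (≡.subst (λ N → [ + n ] ∣ [ + N ] * y) (≡.sym eq) (multiple-k u)) (multiple-n v)
    bézout (Bézout.Identity.-+ u v eq) = []-∣-difference n (gcd k n) (u ℕ.* k)
      (≡.subst (λ N → [ + n ] ∣ [ + N ] * y) (≡.sym eq) (multiple-n v)) (multiple-k u)

  -- The product structure is recorded so that `remove-multiplier` can strip the factors one at a
  -- time.
  data Multiplier (d : ℕ) : Carrier → Set c where
    one  : Multiplier d 1#
    [_]ₘ : ∀ {k} → 0 ℕ.< k × k ℕ.< d → Multiplier d [ + k ]
    _*ₘ_ : ∀ {a b} → Multiplier d a → Multiplier d b → Multiplier d (a * b)

  -- Over a torsion-free R, divisibility by the d-th cyclotomic polynomial in q: a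
  -- multiplier may remove the other cyclotomic factors of [d], but not this one.
  record Vanishes (d : ℕ) (y : Carrier) : Set (c ⊔ ℓ) where
    constructor vanishes
    field
      {multiplier} : Carrier
      isMultiplier : Multiplier d multiplier
      d∣multiple   : [ + d ] ∣ multiplier * y

  module _ (d : ℕ) where

    Vanishes-resp : ∀ {x y} → x ≈ y → Vanishes d x → Vanishes d y
    Vanishes-resp x≈y (vanishes m d∣mx) = vanishes m (∣ʳ-respʳ-≈ (*-congˡ x≈y) d∣mx)

    Vanishes-0 : Vanishes d 0#
    Vanishes-0 = vanishes one (∣ʳ-respʳ-≈ (sym (zeroʳ 1#)) (_ ∣0))

    Vanishes-+ : ∀ {x y} → Vanishes d x → Vanishes d y → Vanishes d (x + y)
    Vanishes-+ (vanishes {a} m d∣ax) (vanishes {b} m′ d∣by) = vanishes (m *ₘ m′)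
      (∣ʳ-respʳ-≈ (SS.solve 4 (λ a b x y → b SS.:* (a SS.:* x) SS.:+ a SS.:* (b SS.:* y) SS.:= a SS.:* b SS.:* (x SS.:+ y)) refl _ _ _ _)
        (∣-+ (x∣ʳy⇒x∣ʳzy b d∣ax) (x∣ʳy⇒x∣ʳzy a d∣by)))

    Vanishes-* : ∀ x {y} → Vanishes d y → Vanishes d (x * y)
    Vanishes-* x (vanishes m d∣my) = vanishes m (∣ʳ-respʳ-≈ (*-CS.x∙yz≈y∙xz _ _ _) (x∣ʳy⇒x∣ʳzy x d∣my))

    Vanishes-[d] : Vanishes d [ + d ]
    Vanishes-[d] = vanishes one (1# , refl)

    Vanishes-cancel : ∀ {k} → 0 ℕ.< k → k ℕ.< d → ∀ {y} → Vanishes d ([ + k ] * y) → Vanishes d y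
    Vanishes-cancel 0<k k<d (vanishes m d∣m[k]y) =
      vanishes (m *ₘ [ 0<k , k<d ]ₘ) (∣ʳ-respʳ-≈ (sym (*-assoc _ _ _)) d∣m[k]y)

    open IdealQuotient R (Vanishes d) Vanishes-resp Vanishes-0 Vanishes-+ Vanishes-* public

  module _
    (torsion-free : ∀ n t .{{_ : NonZero n}} .{{_ : NonZero t}} {y} → [ + n ] ∣ t ×ᴿ y → [ + n ] ∣ y)
    where

    Vanishes-halve : ∀ d .{{_ : NonZero d}} {y} → Vanishes d (y + y) → Vanishes d y
    Vanishes-halve d (vanishes {a} m d∣a[y+y]) = vanishes m (torsion-free d 2
      (∣ʳ-respʳ-≈ (trans (distribˡ _ _ _) (+-congˡ (sym (+-identityʳ _)))) d∣a[y+y]))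

    -- For a product a b, the factor a is removed first, from a (b y): divisibility of y by the
    -- q-integers of proper divisors is inherited by b y. For a single `[ k ]`, the gcd of k and n
    -- is at most k < n, hence a proper divisor of n.
    remove-multiplier : ∀ n .{{_ : NonZero n}} {a y} → Multiplier n a →
      (∀ g → g ℕ∣.∣ n → g ℕ.< n → [ + g ] ∣ y) → [ + n ] ∣ a * y → [ + n ] ∣ y
    remove-multiplier n one proper n∣ay = ∣ʳ-respʳ-≈ (*-identityˡ _) n∣ay
    remove-multiplier n (_*ₘ_ {a} {b} m m′) proper n∣ay = remove-multiplier n m′ proper
      (remove-multiplier n m (λ g g∣n g<n → x∣ʳy⇒x∣ʳzy b (proper g g∣n g<n)) (∣ʳ-respʳ-≈ (*-assoc _ _ _) n∣ay))
    remove-multiplier n {y = y} ([_]ₘ {k} (0<k , k<n)) proper n∣ky = by-cofactor (gcd[m,n]∣n k n)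
      where
      instance
        k≢0 : NonZero k
        k≢0 = ℕ.>-nonZero 0<k
      g = gcd k n
      [g]∣y : [ + g ] ∣ y
      [g]∣y = proper g (gcd[m,n]∣n k n) (ℕ.≤-<-trans (ℕ∣.∣⇒≤ (gcd[m,n]∣m k n)) k<n)
      by-cofactor : g ℕ∣.∣ n → [ + n ] ∣ y
      by-cofactor (divides t n≡tg) = torsion-free n t
        (≡.subst (λ N → [ + N ] ∣ t ×ᴿ y) (≡.sym n≡tg)
          (gcd-step t g [g]∣y (≡.subst (λ N → [ + N ] ∣ [ + g ] * y) n≡tg ([]-∣-gcd k n n∣ky))))
        where
        instance
          t≢0 : NonZero t
          t≢0 = ℕ.m*n≢0⇒m≢0 t {{≡.subst NonZero n≡tg (ℕ.>-nonZero (ℕ.<-trans 0<k k<n))}}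

    ∣-nonZero : ∀ {g n} .{{_ : NonZero n}} → g ℕ∣.∣ n → NonZero g
    ∣-nonZero (divides t ≡.refl) = ℕ.m*n≢0⇒n≢0 t

    descent : ∀ n .{{_ : NonZero n}} {y} → (∀ d → d ℕ∣.∣ n → Vanishes d y) → [ + n ] ∣ y
    descent n {y} = <-rec P step n
      where
      P : ℕ → Set _
      P n = .{{_ : NonZero n}} → (∀ d → d ℕ∣.∣ n → Vanishes d y) → [ + n ] ∣ y
      step : ∀ n → (∀ {g} → g ℕ.< n → P g) → P n
      -- The multiplier for d = n itself is the one to remove; the hypothesis for the divisors of a
      -- proper divisor g is part of that for n.
      step n rec vanish with vanishes m n∣my ← vanish n ℕ∣.∣-refl =
        remove-multiplier n m
          (λ g g∣n g<n → rec g<n {{∣-nonZero g∣n}} (λ d d∣g → vanish d (ℕ∣.∣-trans d∣g g∣n))) n∣my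

    []-∣-∑-summand : ∀ x α m r n .{{_ : NonZero α}} .{{_ : NonZero r}} .{{_ : NonZero n}} →
      [ + n ] ∣ ∑[ i < n ] summand x α m r n (toℕ i)
    []-∣-∑-summand x α m r n = descent n vanish
      where
      vanish : ∀ d → d ℕ∣.∣ n → Vanishes d (∑[ i < n ] summand x α m r n (toℕ i))
      vanish d d∣n@(divides t n≡td) = ≈ᴵ0⇒I d (S.trans (S.trans (φ-∑ n _) (sum-cong-≋ {n} λ i → φ-summand x α m r n (toℕ i)))
        (≡.subst (λ N → sum {N} (λ i → summand′ x α m r n (toℕ i)) S.≈ 0#) (≡.sym n≡td) (∑-summand x α m r n t)))
        where
        instance
          d≢0 : NonZero d
          d≢0 = ∣-nonZero d∣n
        module S = CommutativeRing (R/I d)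
        open CommutativeMonoidSum S.+-commutativeMonoid using (sum; sum-cong-≋)
        open Transport R (R/I d) id (id-isRingHomomorphism d) q^_ q^0≈1 q^-homo
        open Summands (R/I d) q^_ φq^0≈1 φq^-homo using (module AtRootOfUnity) renaming (summand to summand′)
        -- Modulo the ideal of elements vanishing at d, `[ d ]` is 0, a factor `[ k ]` can be
        -- absorbed into the multiplier, and 2 is cancelled by torsion-freeness.
        open AtRootOfUnity d
          (S.trans (S.sym (φ-[] (+ d))) (I⇒≈ᴵ0 d (Vanishes-[d] d)))
          (λ {k} 0<k k<d {y} [k]y≈0 → I⇒≈ᴵ0 d (Vanishes-cancel d 0<k k<d
            (≈ᴵ0⇒I d (S.trans (S.*-congʳ (φ-[] (+ k))) [k]y≈0))))
          (λ {y} y+y≈0 → I⇒≈ᴵ0 d (Vanishes-halve d (≈ᴵ0⇒I d y+y≈0)))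

-- Residues modulo one element, and torsion-freeness modulo a factor of it.

module Residues {c ℓ : Level} (R : CommutativeRing c ℓ) where

  open CommutativeRing R
  open Multiples semiring using (×-assoc-*) renaming (_×_ to _×ᴿ_)
  open RawMagma *-rawMagma using (_∣_; _,_)
  open SetoidReasoning setoid
  open CommutativeSemigroupProperties +-commutativeSemigroup using (interchange)
  private
    module RP = RingProperties ring

  residue-* : ∀ m {D p y} → D * p ≈ 1# - y → m * y ≈ - (m * D) * p + m
  residue-* m {D} {p} {y} Dp≈1-y = begin
    m * y                        ≈⟨ *-congˡ (begin
      1# - D * p                   ≈⟨ +-congˡ (-‿cong Dp≈1-y) ⟩
      1# - (1# - y)                ≈⟨ +-congˡ (RP.⁻¹-anti-homo‿- 1# y) ⟩
      1# + (y - 1#)                ≈⟨ +-comm _ _ ⟩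
      (y - 1#) + 1#                ≈⟨ +-assoc _ _ _ ⟩
      y + (- 1# + 1#)              ≈⟨ trans (+-congˡ (-‿inverseˡ 1#)) (+-identityʳ y) ⟩
      y                            ∎) ⟨
    m * (1# - D * p)             ≈⟨ RP.x[y-z]≈xy-xz _ _ _ ⟩
    m * 1# - m * (D * p)         ≈⟨ +-cong (*-identityʳ m) (-‿cong (sym (*-assoc _ _ _))) ⟩
    m - m * D * p                ≈⟨ +-comm _ _ ⟩
    - (m * D * p) + m            ≈⟨ +-congʳ (RP.-‿distribˡ-* _ _) ⟩
    - (m * D) * p + m            ∎

  residue-+ : ∀ {D D′ p y y′ z z′} → y ≈ D * p + z → y′ ≈ D′ * p + z′ → y + y′ ≈ (D + D′) * p + (z + z′)
  residue-+ eq eq′ = trans (+-cong eq eq′) (trans (interchange _ _ _ _) (+-congʳ (sym (distribʳ _ _ _))))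

  residue-0 : ∀ {D p y z} → y ≈ D * p + z → z ≈ 0# → D * p ≈ y
  residue-0 y≈ z≈0 = sym (trans y≈ (trans (+-congˡ z≈0) (+-identityʳ _)))

  -- Since u is cancellable, N divides y as soon as p = N u divides y u. This is applied with N =
  -- `[ n ]`, u = 1 - q and p = 1 - q^n.
  torsion-free-cofactor : ∀ {N u p} → N * u ≈ p → (∀ y → y * u ≈ 0# → y ≈ 0#) →
    ∀ t → (∀ y b → t ×ᴿ y ≈ b * p → p ∣ y) → ∀ y → N ∣ t ×ᴿ y → N ∣ y
  torsion-free-cofactor {N} {u} {p} Nu≈p cancel t tf y (b , bN≈ty) = cofactor (tf (y * u) b (begin
    t ×ᴿ (y * u)     ≈⟨ ×-assoc-* t y u ⟨
    (t ×ᴿ y) * u     ≈⟨ *-congʳ bN≈ty ⟨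
    b * N * u        ≈⟨ trans (*-assoc _ _ _) (*-congˡ Nu≈p) ⟩
    b * p            ∎))
    where
    cofactor : p ∣ y * u → N ∣ y
    cofactor (D , Dp≈yu) = D , RP.x∙y⁻¹≈ε⇒x≈y _ _ (cancel (D * N - y) (begin
      (D * N - y) * u        ≈⟨ RP.[y-z]x≈yx-zx _ _ _ ⟩
      D * N * u - y * u      ≈⟨ +-congʳ (trans (*-assoc _ _ _) (trans (*-congˡ Nu≈p) Dp≈yu)) ⟩
      y * u - y * u          ≈⟨ -‿inverseʳ _ ⟩
      0#                     ∎))

-- The distance between r and r′ is a multiple of n smaller than n, hence 0.
remainder-unique : ∀ {n r r′} q q′ → r ℕ.< n → r′ ℕ.< n →
  + r ℤ.+ q ℤ.* + n ≡ + r′ ℤ.+ q′ ℤ.* + n → r ≡ r′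
remainder-unique {n} {r} {r′} q q′ r<n r′<n eq =
  ℤ.+-injective (ℤ.i-j≡0⇒i≡j (+ r) (+ r′) (ℤ.∣i∣≡0⇒i≡0 (zero-multiple ℤ.∣ q′ ℤ.- q ∣ distance small)))
  where
  difference : + r ℤ.- + r′ ≡ (q′ ℤ.- q) ℤ.* + n
  difference = ≡.trans
    (solve 4 (λ r r′ a b → r :- r′ := (r :+ a) :- (r′ :+ b) :+ (b :- a)) ≡.refl (+ r) (+ r′) (q ℤ.* + n) (q′ ℤ.* + n))
    (≡.trans (≡.cong (λ s → s ℤ.- (+ r′ ℤ.+ q′ ℤ.* + n) ℤ.+ (q′ ℤ.* + n ℤ.- q ℤ.* + n)) eq)
      (solve 4 (λ s q q′ n → s :- s :+ (q′ :* n :- q :* n) := (q′ :- q) :* n) ≡.refl (+ r′ ℤ.+ q′ ℤ.* + n) q q′ (+ n)))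
    where open +-*-Solver
  distance : ℤ.∣ + r ℤ.- + r′ ∣ ≡ ℤ.∣ q′ ℤ.- q ∣ ℕ.* n
  distance = ≡.trans (≡.cong ℤ.∣_∣ difference) (ℤ.abs-* (q′ ℤ.- q) (+ n))
  small : ℤ.∣ q′ ℤ.- q ∣ ℕ.* n ℕ.< n
  small = ≡.subst (ℕ._< n) (≡.trans (≡.cong ℤ.∣_∣ (≡.sym (ℤ.[+m]-[+n]≡m⊖n r r′))) distance)
    (ℕ.≤-<-trans (ℤ.∣m⊝n∣≤m⊔n r r′) (ℕ.⊔-lub r<n r′<n))
  zero-multiple : ∀ m → ℤ.∣ + r ℤ.- + r′ ∣ ≡ m ℕ.* n → m ℕ.* n ℕ.< n → ℤ.∣ + r ℤ.- + r′ ∣ ≡ 0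
  zero-multiple zero    eq _  = eq
  zero-multiple (suc m) _  lt = contradiction lt (ℕ.m+n≮m n (m ℕ.* n))

%ℕ-periodic : ∀ i n .{{_ : NonZero n}} → (i ℤ.+ + n) %ℕ n ≡ i %ℕ n
%ℕ-periodic i n = remainder-unique ((i ℤ.+ + n) /ℕ n) (i /ℕ n ℤ.+ + 1) (n%ℕd<d (i ℤ.+ + n) n) (n%ℕd<d i n)
  (≡.trans (≡.sym (a≡a%ℕn+[a/ℕn]*n (i ℤ.+ + n) n))
    (≡.trans (≡.cong (ℤ._+ + n) (a≡a%ℕn+[a/ℕn]*n i n))
      (solve 3 (λ r q n → r :+ q :* n :+ n := r :+ (q :+ con (+ 1)) :* n) ≡.refl (+ (i %ℕ n)) (i /ℕ n) (+ n))))
  where open +-*-Solver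

open import Defs

-- Linear functionals on Laurent polynomials and cancellation of 1 - q.

module L = CommutativeRing ℤ[q^±1]
module L[x] = CommutativeRing ℤ[q^±1][x]
module ℒ = Laurent
module 𝒫 = Polynomial
open Multiples L.semiring using () renaming (_×_ to _×ₗ_)
open Multiples L[x].semiring using (×-assoc-*) renaming (_×_ to _×ₓ_)

extend-× : ∀ t a f → ℒ.extend (t ×ₗ a) f ≡ + t ℤ.* ℒ.extend a f
extend-× zero    a f = ≡.sym (ℤ.*-zeroˡ (ℒ.extend a f))
extend-× (suc t) a f = ≡.trans (ℒ.extend-+ₚ a (t ×ₗ a) f)
  (≡.trans (≡.cong (λ s → ℒ.extend a f ℤ.+ s) (extend-× t a f)) (≡.sym (ℤ.suc-* (+ t) (ℒ.extend a f))))

extend-*[1-q^] : ∀ a N f → ℒ.extend (a L.* (L.1# L.- q^ N)) f ≡ ℒ.extend a (λ i → f i ℤ.- f (i ℤ.+ N))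
extend-*[1-q^] a N f = ≡.trans (ℒ.extend-*ₚ a (L.1# L.- q^ N) f) (ℒ.extend-cong a λ i →
  ≡.trans (solve 2 (λ x y → con (+ 1) :* x :+ (con (ℤ.- + 1) :* y :+ con (+ 0)) := x :- y) ≡.refl (f (i ℤ.+ + 0)) (f (i ℤ.+ N)))
    (≡.cong (λ j → f j ℤ.- f (i ℤ.+ N)) (ℤ.+-identityʳ i)))
  where open +-*-Solver

-- Normalised to be 0 at 0: for i > 0 it is minus the sum of f over 0, ..., i - 1, and for i < 0 the
-- sum of f over i, ..., -1.
antidifference : (ℤ → ℤ) → ℤ → ℤ
antidifference f (+ zero)     = + 0
antidifference f (+ suc n)    = antidifference f (+ n) ℤ.- f (+ n)
antidifference f -[1+ zero ]  = f -[1+ 0 ]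
antidifference f -[1+ suc n ] = antidifference f -[1+ n ] ℤ.+ f -[1+ suc n ]

antidifference-step : ∀ f i → antidifference f i ℤ.- antidifference f (i ℤ.+ + 1) ≡ f i
antidifference-step f (+ n) rewrite ℕ.+-comm n 1 =
  solve 2 (λ x y → x :- (x :- y) := y) ≡.refl (antidifference f (+ n)) (f (+ n))
  where open +-*-Solver
antidifference-step f -[1+ zero ]  = ℤ.+-identityʳ (f -[1+ 0 ])
antidifference-step f -[1+ suc n ] =
  solve 2 (λ x y → (x :+ y) :- x := y) ≡.refl (antidifference f -[1+ n ]) (f -[1+ suc n ])
  where open +-*-Solver

-- Multiplication by 1 - q is adjoint to differencing, and every function on ℤ is
-- a difference.
1-q-cancel : ∀ a → a L.* (L.1# L.- q^ (+ 1)) L.≈ L.0# → a L.≈ L.0#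
1-q-cancel a a[1-q]≈0 = ℒ.extend-injective λ f →
  ≡.trans (ℒ.extend-cong a (λ i → ≡.sym (antidifference-step f i)))
    (≡.trans (≡.sym (extend-*[1-q^] a (+ 1) (antidifference f)))
      (ℒ.extend-≈ₚ a[1-q]≈0 (antidifference f)))

-- Reduction of Laurent polynomials modulo 1 - q^n.

module Fold (n : ℕ) .{{_ : NonZero n}} where

  open Residues ℤ[q^±1]

  -- A representative modulo 1 - q^n with exponents from 0 to n - 1, as `fold-mod` shows. By
  -- `fold-vanishes` it is 0 for every torsion element of the quotient.
  fold : L.Carrier → L.Carrier
  fold = map (map₂ (λ i → + (i %ℕ n)))

  extend-fold : ∀ a f → ℒ.extend (fold a) f ≡ ℒ.extend a (λ i → f (+ (i %ℕ n)))
  extend-fold []            f = ≡.refl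
  extend-fold ((a , i) ∷ p) f = ≡.cong (λ s → a ℤ.* f (+ (i %ℕ n)) ℤ.+ s) (extend-fold p f)

  -- f ∘ (_%ℕ n) is n-periodic, so its linear extension kills multiples of 1 - q^n.
  fold-vanishes : ∀ t .{{_ : NonZero t}} a b → t ×ₗ a L.≈ b L.* (L.1# L.- q^ (+ n)) → fold a L.≈ L.0#
  fold-vanishes t a b ta≈ = ℒ.extend-injective λ f →
    ≡.trans (extend-fold a f) (ℤ.*-cancelˡ-≡ (+ t) _ (+ 0)
      (≡.trans (≡.sym (extend-× t a _))
        (≡.trans (ℒ.extend-≈ₚ ta≈ _)
          (≡.trans (extend-*[1-q^] b (+ n) _)
            (≡.trans (ℒ.extend-cong b λ i → ≡.trans
                (≡.cong (λ r → f (+ (i %ℕ n)) ℤ.- f (+ r)) (%ℕ-periodic i n)) (ℤ.+-inverseʳ (f (+ (i %ℕ n)))))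
              (≡.trans (extend-zero b) (≡.sym (ℤ.*-zeroʳ (+ t)))))))))
    where
    extend-zero : ∀ b → ℒ.extend b (λ _ → + 0) ≡ + 0
    extend-zero []            = ≡.refl
    extend-zero ((b , i) ∷ p) = ≡.trans (≡.cong₂ ℤ._+_ (ℤ.*-zeroʳ b) (extend-zero p)) ≡.refl

  private
    -- With q^n in place of q, the q-integers are the quotients of 1 - q^(tn) by 1 - q^n, for
    -- negative t as well.
    module qⁿ = QAnalogues ℤ[q^±1] (λ N → q^ (N ℤ.* + n)) L.refl
      (λ a b → L.reflexive (≡.cong q^_ (≡.sym (ℤ.*-distribʳ-+ (+ n) a b))))

  1-q^n : L.Carrier
  1-q^n = L.1# L.- q^ (+ n)

  monomial-split : ∀ b i → ℒ.monomial b i ≡ ℒ.monomial b (+ (i %ℕ n)) L.* q^ (i /ℕ n ℤ.* + n)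
  monomial-split b i = ≡.cong₂ ℒ.monomial (≡.sym (ℤ.*-identityʳ b)) (a≡a%ℕn+[a/ℕn]*n i n)

  1-q^n∣ : ∀ t → ∃[ D ] D L.* 1-q^n L.≈ L.1# L.- q^ (t ℤ.* + n)
  1-q^n∣ t = D , ≡.subst (λ N → D L.* (L.1# L.- q^ N) L.≈ L.1# L.- q^ (t ℤ.* + n)) (ℤ.*-identityˡ (+ n))
    (RawMagma._∣ʳ_.equality (qⁿ.1-q∣1-q^ t))
    where
    D = qⁿ.[ t ]

  monomial-mod : ∀ b i → ∃[ D ] ℒ.monomial b i L.≈ D L.* 1-q^n L.+ ℒ.monomial b (+ (i %ℕ n))
  monomial-mod b i = let D , eq = 1-q^n∣ (i /ℕ n) in
    L.- (m L.* D) , L.trans (L.reflexive (monomial-split b i))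
      (residue-* m {D} {1-q^n} {q^ (i /ℕ n ℤ.* + n)} eq)
    where
    m = ℒ.monomial b (+ (i %ℕ n))

  fold-mod : ∀ a → ∃[ D ] a L.≈ D L.* 1-q^n L.+ fold a
  fold-mod []            = L.0# , L.refl
  fold-mod ((b , i) ∷ a) = let D , eq = monomial-mod b i; D′ , eq′ = fold-mod a in
    D L.+ D′ , residue-+ {D} {D′} {1-q^n} {ℒ.monomial b i} {a} {ℒ.monomial b (+ (i %ℕ n))} {fold a} eq eq′

-- Polynomials in x, treated coefficient by coefficient.

monomial-cong : ∀ {a b} i → a L.≈ b → 𝒫.monomial a i L[x].≈ 𝒫.monomial b i
monomial-cong i a≈b = 𝒫.extend-injective λ f → L.+-congʳ {L.0#} (L.*-congʳ {f i} a≈b)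

monomial-+ : ∀ a b i → 𝒫.monomial (a L.+ b) i L[x].≈ 𝒫.monomial a i L[x].+ 𝒫.monomial b i
monomial-+ a b i = 𝒫.extend-injective λ f →
  L.trans (L.+-congʳ {L.0#} (L.distribʳ (f i) a b)) (L.+-assoc (a L.* f i) (b L.* f i) L.0#)

monomial-*const : ∀ a b i → 𝒫.monomial (a L.* b) i L[x].≈ 𝒫.monomial a i L[x].* const b
monomial-*const a b i = L[x].reflexive (≡.cong (𝒫.monomial (a L.* b)) (≡.sym (ℕ.+-identityʳ i)))

const-isRingHomomorphism : RingMorphisms.IsRingHomomorphism L.rawRing L[x].rawRing const
const-isRingHomomorphism = record
  { isSemiringHomomorphism = record
    { isNearSemiringHomomorphism = record
      { +-isMonoidHomomorphism = record
        { isMagmaHomomorphism = record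
          { isRelHomomorphism = record { cong = monomial-cong 0 }
          ; homo = λ a b → monomial-+ a b 0
          }
        ; ε-homo = 𝒫.extend-injective λ f → L.refl
        }
      ; *-homo = λ a b → L[x].refl
      }
    ; 1#-homo = L[x].refl
    }
  ; -‿homo = λ a → L[x].refl
  }

coeff-+ₚ : ∀ p r e → 𝒫.coeff (p L[x].+ r) e L.≈ 𝒫.coeff p e L.+ 𝒫.coeff r e
coeff-+ₚ []            r e = L.refl
coeff-+ₚ ((a , i) ∷ p) r e with does (i ℕ.≟ e)
... | true  = L.trans (L.+-congˡ {a} (coeff-+ₚ p r e)) (L.sym (L.+-assoc a (𝒫.coeff p e) (𝒫.coeff r e)))
... | false = coeff-+ₚ p r e

coeff-× : ∀ t p e → 𝒫.coeff (t ×ₓ p) e L.≈ t ×ₗ 𝒫.coeff p e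
coeff-× zero    p e = L.refl
coeff-× (suc t) p e = L.trans (coeff-+ₚ p (t ×ₓ p) e) (L.+-congˡ {𝒫.coeff p e} (coeff-× t p e))

coeff-*const : ∀ p a e → 𝒫.coeff (p L[x].* const a) e L.≈ 𝒫.coeff p e L.* a
coeff-*const []            a e = L.refl
coeff-*const ((b , i) ∷ p) a e rewrite ℕ.+-identityʳ i with does (i ℕ.≟ e)
... | true  = L.trans (L.+-congˡ {b L.* a} (coeff-*const p a e)) (L.sym (L.distribʳ a b (𝒫.coeff p e)))
... | false = coeff-*const p a e

1-q : L.Carrier
1-q = L.1# L.- q^ (+ 1)

const[1-q]-cancel : ∀ p → p L[x].* const 1-q L[x].≈ L[x].0# → p L[x].≈ L[x].0#
const[1-q]-cancel p p[1-q]≈0 = 𝒫.mk≈ λ e → 1-q-cancel (𝒫.coeff p e)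
  (L.trans (L.sym (coeff-*const p 1-q e)) (𝒫.coeff-≈ p[1-q]≈0 e))

-- Torsion-freeness of the polynomial ring modulo the q-integer of n.

module PolynomialFold (n : ℕ) .{{_ : NonZero n}} where

  open Fold n
  open Residues ℤ[q^±1][x]

  foldₓ : L[x].Carrier → L[x].Carrier
  foldₓ = map (map₁ fold)

  coeff-foldₓ : ∀ p e → 𝒫.coeff (foldₓ p) e ≡ fold (𝒫.coeff p e)
  coeff-foldₓ []            e = ≡.refl
  coeff-foldₓ ((a , i) ∷ p) e with does (i ℕ.≟ e)
  ... | true  = ≡.trans (≡.cong (fold a L.+_) (coeff-foldₓ p e)) (≡.sym (map-++ _ a (𝒫.coeff p e)))
  ... | false = coeff-foldₓ p e

  foldₓ-mod : ∀ p → ∃[ D ] p L[x].≈ D L[x].* const 1-q^n L[x].+ foldₓ p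
  foldₓ-mod []            = L[x].0# , L[x].refl
  foldₓ-mod ((a , i) ∷ p) = let D , eq = fold-mod a; D′ , eq′ = foldₓ-mod p in
    𝒫.monomial D i L[x].+ D′ ,
    residue-+ {𝒫.monomial D i} {D′} {const 1-q^n} {𝒫.monomial a i} {p} {𝒫.monomial (fold a) i} {foldₓ p}
      (L[x].trans (monomial-cong i eq) (L[x].trans (monomial-+ (D L.* 1-q^n) (fold a) i)
        (L[x].+-congʳ {𝒫.monomial (fold a) i} (monomial-*const D 1-q^n i))))
      eq′

  -- Modulo 1 - q^n, p equals its folding, and by `fold-vanishes` the folding has all coefficients
  -- 0.
  torsion-free-1-q^n : ∀ t .{{_ : NonZero t}} p b → t ×ₓ p L[x].≈ b L[x].* const 1-q^n → const 1-q^n ∣ p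
  torsion-free-1-q^n t p b tp≈ = let D , eq = foldₓ-mod p in
    D RawMagma., residue-0 {D} {const 1-q^n} {p} {foldₓ p} eq (𝒫.mk≈ λ e →
      L.trans (L.reflexive (coeff-foldₓ p e))
        (fold-vanishes t (𝒫.coeff p e) (𝒫.coeff b e)
          (L.trans (L.sym (coeff-× t p e)) (L.trans (𝒫.coeff-≈ tp≈ e) (coeff-*const b 1-q^n e)))))

  -- Passes from 1 - q^n to its factor `[ n ]`, the cofactor 1 - q being cancellable.
  torsion-free : ∀ t .{{_ : NonZero t}} p → const [ + n ] ∣ t ×ₓ p → const [ + n ] ∣ p
  torsion-free t = torsion-free-cofactor {const [ + n ]} {const 1-q} {const 1-q^n}
    (monomial-cong 0 (RawMagma._∣ʳ_.equality (Q.1-q∣1-q^ (+ n))))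
    const[1-q]-cancel t (torsion-free-1-q^n t)

-- Conclusion in the ring of polynomials in x over the Laurent polynomials in q.

private
  module const = Transport ℤ[q^±1] ℤ[q^±1][x] const const-isRingHomomorphism
    q^_ L.refl (λ a b → L.refl)
  open CyclotomicDescent ℤ[q^±1][x] (const ∘ q^_) const.φq^0≈1 const.φq^-homo
    using ([]-∣-∑-summand)
  open Summands ℤ[q^±1][x] (const ∘ q^_) const.φq^0≈1 const.φq^-homo
    using (summand) renaming (w to wₓ)
  open QAnalogues ℤ[q^±1][x] (const ∘ q^_) const.φq^0≈1 const.φq^-homo
    using () renaming ([_] to [_]ₓ)
  open SemiringDivisibility L[x].semiring using (∣ʳ-respˡ-≈; ∣ʳ-respʳ-≈)
  open MonoidSum L[x].+-monoid using (sum-cong-≋)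
  open Exponentiation L[x].commutativeSemiring using (^-congˡ)

-- The descent works with q-integers formed inside the polynomial ring; `const.φ-[]` identifies them
-- with the constant polynomials of the theorem.
torsion-freeₓ : ∀ n t .{{_ : NonZero n}} .{{_ : NonZero t}} {p} → [ + n ]ₓ ∣ t ×ₓ p → [ + n ]ₓ ∣ p
torsion-freeₓ n t {p} [n]∣tp = ∣ʳ-respˡ-≈ {p} (const.φ-[] (+ n))
  (PolynomialFold.torsion-free n t p (∣ʳ-respˡ-≈ {t ×ₓ p} (L[x].sym (const.φ-[] (+ n))) [n]∣tp))

w≈ : ∀ α k → w α k L[x].≈ wₓ x α k
w≈ α k = sum-cong-≋ {k} λ i → L[x].*-congʳ {x ^ toℕ i} (const.φ-wCoefficient α k (suc (toℕ i)))

theorem4 : (α m n r : ℕ) .{{_ : NonZero α}} .{{_ : NonZero m}} .{{_ : NonZero n}} .{{_ : NonZero r}} →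
    const [ + n ] ∣
    (∑[ i < n ] (let k = toℕ i in
    const [ + (k ℕ.* (k ℕ.+ 2)) ] ^ r
    * const [ + (2 ℕ.* (k ℕ.+ 1)) ]
    * const (q^ ((+ n ℤ.- + 2 ℤ.- + k) ℤ.* + (2 ℕ.* α ℕ.* m ℕ.+ 1)))
    * (w α k * w α (k ℕ.+ 1)) ^ m))
theorem4 α m n r = ∣ʳ-respˡ-≈ (L[x].sym (const.φ-[] (+ n)))
  (∣ʳ-respʳ-≈ (L[x].sym (sum-cong-≋ {n} λ i → summand≈ (toℕ i)))
    ([]-∣-∑-summand torsion-freeₓ x α m r n))
  where
  summand≈ : ∀ k →
    const [ + (k ℕ.* (k ℕ.+ 2)) ] ^ r
    * const [ + (2 ℕ.* (k ℕ.+ 1)) ]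
    * const (q^ ((+ n ℤ.- + 2 ℤ.- + k) ℤ.* + (2 ℕ.* α ℕ.* m ℕ.+ 1)))
    * (w α k * w α (k ℕ.+ 1)) ^ m
    L[x].≈ summand x α m r n k
  summand≈ k = L[x].*-cong
    (L[x].*-congʳ (L[x].*-cong (^-congˡ r (const.φ-[] (+ (k ℕ.* (k ℕ.+ 2))))) (const.φ-[] (+ (2 ℕ.* (k ℕ.+ 1))))))
    (^-congˡ m (L[x].*-cong (w≈ α k) (w≈ α (k ℕ.+ 1))))
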